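{- Let $M$ be the weighted adjacency matrix of a finite simple loopless graph $G$ on $n$ vertices with edge weights in $\mathbb{Z}[w,r]$, let $C_k(M)$ be the total weight of the unoriented simple $k$-cycles of $G$, and let $k\ge3$. Then $$C_k(M)=\frac{1}{2k}\sum_{\substack{T\subseteq[n]\\|T|=k}}\ \sum_{S\subseteq T}(-1)^{k-|S|}\operatorname{tr}\bigl(M[S]^k\bigr)=\frac{1}{2k}\sum_{\substack{S\subseteq[n]\\|S|\le k}}(-1)^{k-|S|}\binom{n-|S|}{k-|S|}\operatorname{tr}\bigl(M[S]^k\bigr),$$ with the convention $\binom ab=0$ for $b<0$ or $b>a$. Consequently, for an oriented non-split alternating link $L$ and $k\ge3$, $$CWR_k(L)=\bigl(C_k(\overline A_B),\,C_k(\overline A_W)\bigr),$$ where $\overline A_B$, $\overline A_W$ are the weighted adjacency matrices of the consolidated Tait graphs $G_B^*$, $G_W^*$ of $L$, and where, for $M=\overline A_B$ and for $M=\overline A_W$ (with $n$ the size of the matrix $M$ in question), $$C_k(M)=\frac{1}{2k}\sum_{\substack{S\subseteq[n]\\|S|\le k}}(-1)^{k-|S|}\binom{n-|S|}{k-|S|}\operatorname{tr}\bigl(M[S]^k\bigr).$$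
   Context: The weighted adjacency matrix $M=(m_{ij})$ of $G$ (vertices $v_1,\ldots,v_n$) is the symmetric matrix with $m_{ij}=\operatorname{wg}(e)$ if $v_i,v_j$ are joined by an edge $e$, and $m_{ij}=0$ otherwise. The weight of a cycle $C$ is $\prod_{e\in E(C)}\operatorname{wg}(e)$, and $C_k(M)$ is the sum of the weights of all unoriented simple cycles of length $k$ in $G$. Write $[n]=\{1,\ldots,n\}$. For $S\subseteq[n]$, $M[S]=(m_{ij})_{i,j\in S}$ is the principal submatrix indexed by $S$; for $S=\varnothing$, $\operatorname{tr}(M[S]^k)=0$ for $k\ge1$. Tait graphs and $CWR$. Let $D$ be a reduced (no nugatory crossings) alternating diagram of an oriented non-split alternating link $L$. The regions of $D$ are checkerboard coloured black and white, so that regions sharing an edge have opposite colours; which class is called black is fixed once and for all by a local rule depending on the over/under pattern at crossings, the same rule for all diagrams (the statement holds for either choice of rule). The Tait graph $G_B$ has one vertex for each black region and one edge for each crossing, joining the black regions meeting at that crossing; $G_W$ is defined in the same way from white regions. Each edge $e$ gets weight $\operatorname{wg}(e)=w$ if the crossing is positive and $r$ if it is negative, where $w,r$ are commuting indeterminates. The consolidated Tait graph $G_B^*$ is the weighted simple graph obtained from $G_B$ by replacing all parallel edges joining the same pair of vertices by a single edge whose weight is the product of their weights; $G_W^*$ is obtained from $G_W$ likewise. For $i>2$, $CB_i(w,r)=\sum_C\prod_{e\in E(C)}\operatorname{wg}(e)$, summed over all unoriented simple cycles $C$ of length $i$ in $G_B^*$; $CW_i$ is defined analogously from $G_W^*$;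 and $CWR_i=(CB_i,CW_i)$. It is a known theorem that $CWR_i$ does not depend on the chosen reduced alternating diagram $D$ of $L$; $CWR_i(L)$ denotes the common value. -}

module Defs where

open import Level using (Level; 0ℓ; _⊔_)
open import Algebra.Bundles using (CommutativeRing; Semiring)
open import Data.Bool.Base using (if_then_else_)
open import Data.Fin.Base using (Fin; zero; suc)
import Data.Fin.Properties as Fin
open import Data.Fin.Subset using (Subset; inside; outside; ∣_∣)
open import Data.Fin.Subset.Properties using (_⊆?_)
import Data.Integer.Base as ℤ
import Data.Integer.Properties as ℤ
open import Data.List.Base
  using (List; []; _∷_; [_]; _++_; _∷ʳ_; map; concat; concatMap; filter; foldr;
         zip; length; lookup; reverse; take; drop; applyUpTo; iterate; deduplicate;
         cartesianProductWith; allFin)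
import Data.List.Membership.DecPropositional as DecMembership
open import Data.List.Membership.Propositional using (_∈_; find)
open import Data.List.Membership.Propositional.Properties using (∈-map⁻; ∈-lookup)
open import Data.List.Properties using (filter-≐) renaming (≡-dec to List-≡-dec)
open import Data.List.Relation.Binary.Disjoint.Propositional using (Disjoint)
open import Data.List.Relation.Binary.Permutation.Propositional using (_↭_)
open import Data.List.Relation.Unary.All using (All; all?)
open import Data.List.Relation.Unary.Any using (Any; any?)
import Data.List.Relation.Unary.Any as Any
open import Data.List.Relation.Unary.Unique.Propositional using (Unique)
import Data.List.Relation.Unary.Unique.DecPropositional as DecUnique
open import Data.Nat.Base using (ℕ; zero; suc; _≤_; _∸_; s≤s)
import Data.Nat.Base as ℕ
import Data.Nat.Properties as ℕ
open import Data.Nat.Combinatorics using (_C_)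
open import Data.Product.Base using (∃₂; ∃-syntax; _×_; _,_; proj₁; proj₂; uncurry; swap; map₁)
open import Data.Product.Properties using (≡-dec)
open import Data.Rational.Base using (ℚ; _/_)
import Data.Rational.Properties as ℚ
open import Data.Sign.Base using (Sign; opposite) renaming (+ to pos; - to neg)
import Data.Sign.Base as Sign
import Data.Sign.Properties as Sign
open import Data.Sum.Base using (_⊎_; inj₁; inj₂; [_,_]′)
import Data.Sum.Base as Sum
open import Data.Vec.Base using (Vec)
import Data.Vec.Base as Vec
open import Function.Base using (_∘_)
open import Function.Definitions using (Injective)
open import Relation.Binary.Construct.Closure.Equivalence using (EqClosure)
open import Relation.Binary.Definitions using (Decidable; DecidableEquality)
open import Relation.Binary.PropositionalEquality using (_≡_; _≢_; cong; subst) renaming (refl to ≡-refl)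
open import Relation.Nullary using (¬_; Dec; yes; no; does)
open import Relation.Nullary.Decidable using (_×-dec_; _⊎-dec_; ¬?)
import Algebra.Properties.Ring as RingProperties
import Algebra.Properties.CommutativeSemigroup as CommutativeSemigroupProperties
import Algebra.Definitions.RawSemiring as RawSemiringDefinitions

private variable
  a c ℓ : Level
  A : Set a

------------------------------------------------------------------------
-- Polynomials in one variable, as lists of coefficients in increasing degree;
-- lists differing by trailing zeros are equal.

module Polynomials (R : CommutativeRing c ℓ) where
  open CommutativeRing R
  open RingProperties ring using (-0#≈0#)
  open CommutativeSemigroupProperties
    (CommutativeRing.+-commutativeSemigroup R) using (interchange)

  coeff : List Carrier → ℕ → Carrier
  coeff []      _       = 0#
  coeff (a ∷ p) zero    = a
  coeff (a ∷ p) (suc n) = coeff p n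

  infix 4 _≈ₚ_
  record _≈ₚ_ (p q : List Carrier) : Set ℓ where
    constructor coeffwise
    field at : ∀ n → coeff p n ≈ coeff q n
  open _≈ₚ_ public

  infixl 6 _+ₚ_
  _+ₚ_ : List Carrier → List Carrier → List Carrier
  []      +ₚ q       = q
  (a ∷ p) +ₚ []      = a ∷ p
  (a ∷ p) +ₚ (b ∷ q) = a + b ∷ p +ₚ q

  -ₚ_ : List Carrier → List Carrier
  -ₚ_ = map (-_)

  scale : Carrier → List Carrier → List Carrier
  scale a = map (a *_)

  infixl 7 _*ₚ_
  _*ₚ_ : List Carrier → List Carrier → List Carrier
  []      *ₚ q = []
  (a ∷ p) *ₚ q = scale a q +ₚ (0# ∷ p *ₚ q)

  constant : Carrier → List Carrier
  constant a = a ∷ []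

  variable-X : List Carrier
  variable-X = 0# ∷ 1# ∷ []

  private
    reflₚ : ∀ {p} → p ≈ₚ p
    reflₚ = coeffwise λ _ → refl

    symₚ : ∀ {p q} → p ≈ₚ q → q ≈ₚ p
    symₚ e = coeffwise λ n → sym (at e n)

    transₚ : ∀ {p q r} → p ≈ₚ q → q ≈ₚ r → p ≈ₚ r
    transₚ e f = coeffwise λ n → trans (at e n) (at f n)

    ∷-cong : ∀ {a b p q} → a ≈ b → p ≈ₚ q → a ∷ p ≈ₚ b ∷ q
    ∷-cong a≈b p≈q = coeffwise λ { zero → a≈b ; (suc n) → at p≈q n }

    ∷-zero : ∀ {a p} → a ≈ 0# → p ≈ₚ [] → a ∷ p ≈ₚ []
    ∷-zero a≈0 p≈0 = coeffwise λ { zero → a≈0 ; (suc n) → at p≈0 n }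

    tail-≈ : ∀ {a b p q} → a ∷ p ≈ₚ b ∷ q → p ≈ₚ q
    tail-≈ e = coeffwise λ n → at e (suc n)

    tail-≈[] : ∀ {a p} → a ∷ p ≈ₚ [] → p ≈ₚ []
    tail-≈[] e = coeffwise λ n → at e (suc n)

  coeff-+ : ∀ p q n → coeff (p +ₚ q) n ≈ coeff p n + coeff q n
  coeff-+ []      q       n       = sym (+-identityˡ _)
  coeff-+ (a ∷ p) []      n       = sym (+-identityʳ _)
  coeff-+ (a ∷ p) (b ∷ q) zero    = refl
  coeff-+ (a ∷ p) (b ∷ q) (suc n) = coeff-+ p q n

  coeff-neg : ∀ p n → coeff (-ₚ p) n ≈ - coeff p n
  coeff-neg []      n       = sym -0#≈0#
  coeff-neg (a ∷ p) zero    = refl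
  coeff-neg (a ∷ p) (suc n) = coeff-neg p n

  coeff-scale : ∀ a p n → coeff (scale a p) n ≈ a * coeff p n
  coeff-scale a []      n       = sym (zeroʳ a)
  coeff-scale a (b ∷ p) zero    = refl
  coeff-scale a (b ∷ p) (suc n) = coeff-scale a p n

  private
    +ₚ-cong : ∀ {p p′ q q′} → p ≈ₚ p′ → q ≈ₚ q′ → p +ₚ q ≈ₚ p′ +ₚ q′
    +ₚ-cong {p} {p′} {q} {q′} e f = coeffwise λ n →
      trans (coeff-+ p q n) (trans (+-cong (at e n) (at f n)) (sym (coeff-+ p′ q′ n)))

    +ₚ-comm : ∀ p q → p +ₚ q ≈ₚ q +ₚ p
    +ₚ-comm p q = coeffwise λ n →
      trans (coeff-+ p q n) (trans (+-comm _ _) (sym (coeff-+ q p n)))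

    +ₚ-assoc : ∀ p q r → (p +ₚ q) +ₚ r ≈ₚ p +ₚ (q +ₚ r)
    +ₚ-assoc p q r = coeffwise λ n →
      trans (coeff-+ (p +ₚ q) r n) (trans (+-congʳ (coeff-+ p q n))
      (trans (+-assoc _ _ _)
      (sym (trans (coeff-+ p (q +ₚ r) n) (+-congˡ (coeff-+ q r n))))))

    +ₚ-identityʳ : ∀ p → p +ₚ [] ≈ₚ p
    +ₚ-identityʳ p = +ₚ-comm p []

    +ₚ-interchange : ∀ p q r s → (p +ₚ q) +ₚ (r +ₚ s) ≈ₚ (p +ₚ r) +ₚ (q +ₚ s)
    +ₚ-interchange p q r s = coeffwise λ n →
      trans (coeff-+ (p +ₚ q) (r +ₚ s) n)
      (trans (+-cong (coeff-+ p q n) (coeff-+ r s n))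
      (trans (interchange _ _ _ _)
      (sym (trans (coeff-+ (p +ₚ r) (q +ₚ s) n) (+-cong (coeff-+ p r n) (coeff-+ q s n))))))

    +ₚ-swapˡ : ∀ p q r → p +ₚ (q +ₚ r) ≈ₚ q +ₚ (p +ₚ r)
    +ₚ-swapˡ p q r = transₚ (symₚ (+ₚ-assoc p q r))
      (transₚ (+ₚ-cong (+ₚ-comm p q) (reflₚ {r})) (+ₚ-assoc q p r))

    -ₚ-cong : ∀ {p q} → p ≈ₚ q → -ₚ p ≈ₚ -ₚ q
    -ₚ-cong {p} {q} e = coeffwise λ n →
      trans (coeff-neg p n) (trans (-‿cong (at e n)) (sym (coeff-neg q n)))

    -ₚ-inverseˡ : ∀ p → (-ₚ p) +ₚ p ≈ₚ []
    -ₚ-inverseˡ p = coeffwise λ n →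
      trans (coeff-+ (-ₚ p) p n) (trans (+-congʳ (coeff-neg p n)) (-‿inverseˡ _))

    scale-cong : ∀ {a b p q} → a ≈ b → p ≈ₚ q → scale a p ≈ₚ scale b q
    scale-cong {a} {b} {p} {q} e f = coeffwise λ n →
      trans (coeff-scale a p n) (trans (*-cong e (at f n)) (sym (coeff-scale b q n)))

    scale-zero : ∀ {a} q → a ≈ 0# → scale a q ≈ₚ []
    scale-zero {a} q e = coeffwise λ n →
      trans (coeff-scale a q n) (trans (*-congʳ e) (zeroˡ _))

    scale-one : ∀ q → scale 1# q ≈ₚ q
    scale-one q = coeffwise λ n → trans (coeff-scale 1# q n) (*-identityˡ _)

    scale-+ : ∀ a p q → scale a (p +ₚ q) ≈ₚ scale a p +ₚ scale a q
    scale-+ a p q = coeffwise λ n →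
      trans (coeff-scale a (p +ₚ q) n) (trans (*-congˡ (coeff-+ p q n))
      (trans (distribˡ _ _ _)
      (sym (trans (coeff-+ (scale a p) (scale a q) n)
                  (+-cong (coeff-scale a p n) (coeff-scale a q n))))))

    scale-scale : ∀ a b p → scale a (scale b p) ≈ₚ scale (a * b) p
    scale-scale a b p = coeffwise λ n →
      trans (coeff-scale a (scale b p) n) (trans (*-congˡ (coeff-scale b p n))
      (trans (sym (*-assoc _ _ _)) (sym (coeff-scale (a * b) p n))))

    0∷-+ : ∀ p q → 0# ∷ (p +ₚ q) ≈ₚ (0# ∷ p) +ₚ (0# ∷ q)
    0∷-+ p q = ∷-cong (sym (+-identityˡ 0#)) reflₚ

    *ₚ-zeroʳ : ∀ p → p *ₚ [] ≈ₚ []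
    *ₚ-zeroʳ []      = reflₚ
    *ₚ-zeroʳ (a ∷ p) = ∷-zero refl (*ₚ-zeroʳ p)

    *ₚ-congˡ : ∀ p {q q′} → q ≈ₚ q′ → p *ₚ q ≈ₚ p *ₚ q′
    *ₚ-congˡ []      e = reflₚ
    *ₚ-congˡ (a ∷ p) e = +ₚ-cong (scale-cong refl e) (∷-cong refl (*ₚ-congˡ p e))

    *ₚ-zeroˡ : ∀ p q → p ≈ₚ [] → p *ₚ q ≈ₚ []
    *ₚ-zeroˡ []      q e = reflₚ
    *ₚ-zeroˡ (a ∷ p) q e =
      +ₚ-cong (scale-zero q (at e 0)) (∷-zero refl (*ₚ-zeroˡ p q (tail-≈[] e)))

    *ₚ-congʳ : ∀ p p′ q → p ≈ₚ p′ → p *ₚ q ≈ₚ p′ *ₚ q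
    *ₚ-congʳ []      p′       q e = symₚ (*ₚ-zeroˡ p′ q (symₚ e))
    *ₚ-congʳ (a ∷ p) []       q e = *ₚ-zeroˡ (a ∷ p) q e
    *ₚ-congʳ (a ∷ p) (b ∷ p′) q e =
      +ₚ-cong (scale-cong (at e 0) reflₚ) (∷-cong refl (*ₚ-congʳ p p′ q (tail-≈ e)))

    *ₚ-∷ : ∀ p b q → p *ₚ (b ∷ q) ≈ₚ scale b p +ₚ (0# ∷ p *ₚ q)
    *ₚ-∷ []      b q = symₚ (∷-zero refl reflₚ)
    *ₚ-∷ (a ∷ p) b q = ∷-cong (+-congʳ (*-comm a b))
      (transₚ (+ₚ-cong (reflₚ {scale a q}) (*ₚ-∷ p b q))
              (+ₚ-swapˡ (scale a q) (scale b p) (0# ∷ p *ₚ q)))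

    *ₚ-comm : ∀ p q → p *ₚ q ≈ₚ q *ₚ p
    *ₚ-comm []      q = symₚ (*ₚ-zeroʳ q)
    *ₚ-comm (a ∷ p) q =
      transₚ (+ₚ-cong (reflₚ {scale a q}) (∷-cong refl (*ₚ-comm p q))) (symₚ (*ₚ-∷ q a p))

    *ₚ-distribˡ : ∀ p q r → p *ₚ (q +ₚ r) ≈ₚ p *ₚ q +ₚ p *ₚ r
    *ₚ-distribˡ []      q r = reflₚ
    *ₚ-distribˡ (a ∷ p) q r = transₚ
      (+ₚ-cong (scale-+ a q r)
        (transₚ (∷-cong refl (*ₚ-distribˡ p q r)) (0∷-+ (p *ₚ q) (p *ₚ r))))
      (+ₚ-interchange (scale a q) (scale a r) (0# ∷ p *ₚ q) (0# ∷ p *ₚ r))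

    *ₚ-distribʳ : ∀ p q r → (q +ₚ r) *ₚ p ≈ₚ q *ₚ p +ₚ r *ₚ p
    *ₚ-distribʳ p q r = transₚ (*ₚ-comm (q +ₚ r) p)
      (transₚ (*ₚ-distribˡ p q r) (+ₚ-cong (*ₚ-comm p q) (*ₚ-comm p r)))

    scale-* : ∀ a p q → scale a p *ₚ q ≈ₚ scale a (p *ₚ q)
    scale-* a []      q = reflₚ
    scale-* a (b ∷ p) q = symₚ (transₚ (scale-+ a (scale b q) (0# ∷ p *ₚ q))
      (+ₚ-cong (scale-scale a b q) (∷-cong (zeroʳ a) (symₚ (scale-* a p q)))))

    *ₚ-assoc : ∀ p q r → (p *ₚ q) *ₚ r ≈ₚ p *ₚ (q *ₚ r)
    *ₚ-assoc []      q r = reflₚ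
    *ₚ-assoc (a ∷ p) q r = transₚ (*ₚ-distribʳ r (scale a q) (0# ∷ p *ₚ q))
      (+ₚ-cong (scale-* a q r)
        (+ₚ-cong (scale-zero r refl) (∷-cong refl (*ₚ-assoc p q r))))

    *ₚ-identityˡ : ∀ p → constant 1# *ₚ p ≈ₚ p
    *ₚ-identityˡ p =
      transₚ (+ₚ-cong (scale-one p) (∷-zero refl reflₚ)) (+ₚ-identityʳ p)

  commutativeRing : CommutativeRing c ℓ
  commutativeRing = record
    { Carrier = List Carrier
    ; _≈_ = _≈ₚ_ ; _+_ = _+ₚ_ ; _*_ = _*ₚ_ ; -_ = -ₚ_ ; 0# = [] ; 1# = constant 1#
    ; isCommutativeRing = record
      { isRing = record
        { +-isAbelianGroup = record
          { isGroup = record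
            { isMonoid = record
              { isSemigroup = record
                { isMagma = record
                  { isEquivalence = record { refl = reflₚ ; sym = symₚ ; trans = transₚ }
                  ; ∙-cong = +ₚ-cong }
                ; assoc = +ₚ-assoc }
              ; identity = (λ _ → reflₚ) , +ₚ-identityʳ }
            ; inverse = -ₚ-inverseˡ , (λ p → transₚ (+ₚ-comm p (-ₚ p)) (-ₚ-inverseˡ p))
            ; ⁻¹-cong = -ₚ-cong }
          ; comm = +ₚ-comm }
        ; *-cong = λ {p} {p′} {q} {q′} e f →
            transₚ (*ₚ-congʳ p p′ q e) (*ₚ-congˡ p′ f)
        ; *-assoc = *ₚ-assoc
        ; *-identity = *ₚ-identityˡ
            , (λ p → transₚ (*ₚ-comm p (constant 1#)) (*ₚ-identityˡ p))
        ; distrib = *ₚ-distribˡ , *ₚ-distribʳ }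
      ; *-comm = *ₚ-comm } }

-- K[w,r] is (K[w])[r].

_[w,r] : CommutativeRing c ℓ → CommutativeRing c ℓ
K [w,r] = Polynomials.commutativeRing (Polynomials.commutativeRing K)

ℤ[w,r] ℚ[w,r] : CommutativeRing 0ℓ 0ℓ
ℤ[w,r] = ℤ.+-*-commutativeRing [w,r]
ℚ[w,r] = ℚ.+-*-commutativeRing [w,r]

module ℤ[w,r] = CommutativeRing ℤ[w,r]
module ℚ[w,r] = CommutativeRing ℚ[w,r]

w r : ℤ[w,r].Carrier
w = Polynomials.constant (Polynomials.commutativeRing ℤ.+-*-commutativeRing)
      (Polynomials.variable-X ℤ.+-*-commutativeRing)
r = Polynomials.variable-X (Polynomials.commutativeRing ℤ.+-*-commutativeRing)

-- The inclusion of ℤ[w,r] in ℚ[w,r], and the scalars of ℚ[w,r].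

ι : ℤ[w,r].Carrier → ℚ[w,r].Carrier
ι = map (map (_/ 1))

scalar : ℚ → ℚ[w,r].Carrier
scalar q = [ [ q ] ]

1/2* : (k : ℕ) → 3 ≤ k → ℚ
1/2* (suc k) (s≤s _) = ℤ.+ 1 / (2 ℕ.* suc k)

------------------------------------------------------------------------
-- Cyclic words

cyclicPairs : List A → List (A × A)
cyclicPairs []       = []
cyclicPairs (x ∷ xs) = zip (x ∷ xs) (xs ∷ʳ x)

rotations : List A → List (List A)
rotations xs = applyUpTo (λ i → drop i xs ++ take i xs) (length xs)

-- All ways of reading xs around a circle: from any starting point, in either
-- direction.

traversals : List A → List (List A)
traversals xs = rotations xs ++ rotations (reverse xs)

words : ℕ → List A → List (List A)
words zero    xs = [ [] ]
words (suc k) xs = cartesianProductWith _∷_ xs (words k xs)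

------------------------------------------------------------------------
-- Subsets of [n] and principal submatrices

subsets : ∀ n → List (Subset n)
subsets zero    = [ Vec.[] ]
subsets (suc n) = map (outside Vec.∷_) (subsets n) ++ map (inside Vec.∷_) (subsets n)

-- The elements of S in increasing order.

element : ∀ {n} (S : Subset n) → Fin ∣ S ∣ → Fin n
element (outside Vec.∷ S) i       = suc (element S i)
element (inside  Vec.∷ S) zero    = zero
element (inside  Vec.∷ S) (suc i) = suc (element S i)

------------------------------------------------------------------------
-- Weighted simple graphs and their matrices, over a commutative ring

module Weighted (R : CommutativeRing c ℓ) where
  open CommutativeRing R hiding (zero)
  open RawSemiringDefinitions (Semiring.rawSemiring semiring) using (sum; _^_) renaming (_×_ to _·_)

  ∑ ∏ : List A → (A → Carrier) → Carrier
  ∑ xs f = foldr (λ x s → f x + s) 0# xs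
  ∏ xs f = foldr (λ x s → f x * s) 1# xs

  infix 5 ∑ ∏
  syntax ∑ xs (λ x → e) = ∑[ x ∈ xs ] e
  syntax ∏ xs (λ x → e) = ∏[ x ∈ xs ] e

  Matrix : ℕ → Set c
  Matrix n = Fin n → Fin n → Carrier

  tr : ∀ {n} → Matrix n → Carrier
  tr M = sum (λ i → M i i)

  infixr 8 _^ᴹ_
  _^ᴹ_ : ∀ {n} → Matrix n → ℕ → Matrix n
  (M ^ᴹ zero)  i j = if does (i Fin.≟ j) then 1# else 0#
  (M ^ᴹ suc k) i j = sum (λ l → M i l * (M ^ᴹ k) l j)

  infix 9 _⟦_⟧
  _⟦_⟧ : ∀ {n} → Matrix n → (S : Subset n) → Matrix ∣ S ∣
  (M ⟦ S ⟧) i j = M (element S i) (element S j)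

  -- Only the values of wg on edges matter.
  record Graph (n : ℕ) : Set (Level.suc 0ℓ ⊔ c ⊔ ℓ) where
    field
      Adj     : Fin n → Fin n → Set
      adj?    : Decidable Adj
      irrefl  : ∀ {i} → ¬ Adj i i
      adj-sym : ∀ {i j} → Adj i j → Adj j i
      wg      : Fin n → Fin n → Carrier
      wg-sym  : ∀ {i j} → Adj i j → wg i j ≈ wg j i

  module _ {n : ℕ} (G : Graph n) where
    open Graph G

    adjacencyMatrix : Matrix n
    adjacencyMatrix i j = if does (adj? i j) then wg i j else 0#

    -- A simple cycle is presented by listing its vertices in the order of a
    -- traversal; an unoriented cycle of length k ≥ 3 is a class of such lists
    -- under change of starting point and direction.

    IsSimpleCycle : List (Fin n) → Set
    IsSimpleCycle vs = Unique vs × All (uncurry Adj) (cyclicPairs vs)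

    isSimpleCycle? : ∀ vs → Dec (IsSimpleCycle vs)
    isSimpleCycle? vs =
      DecUnique.unique? Fin._≟_ vs ×-dec all? (uncurry adj?) (cyclicPairs vs)

    SameCycle : List (Fin n) → List (Fin n) → Set
    SameCycle us vs = us ∈ traversals vs

    sameCycle? : Decidable SameCycle
    sameCycle? us vs = us ∈? traversals vs
      where open DecMembership (List-≡-dec Fin._≟_)

    unorientedCycles : ℕ → List (List (Fin n))
    unorientedCycles k =
      deduplicate sameCycle? (filter isSimpleCycle? (words k (allFin n)))

    cycleWeight : List (Fin n) → Carrier
    cycleWeight vs = ∏ (cyclicPairs vs) (uncurry wg)

    cycleSum : ℕ → Carrier
    cycleSum k = ∑ (unorientedCycles k) cycleWeight

  -- ∑_{T ⊆ [n], |T| = k} ∑_{S ⊆ T} (-1)^{k-|S|} tr (M[S]^k)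

  nestedTraceSum : ∀ {n} → ℕ → Matrix n → Carrier
  nestedTraceSum {n} k M =
    ∑[ T ∈ filter (λ T → ∣ T ∣ ℕ.≟ k) (subsets n) ]
    ∑[ S ∈ filter (_⊆? T) (subsets n) ]
      (- 1#) ^ (k ∸ ∣ S ∣) * tr (M ⟦ S ⟧ ^ᴹ k)

  -- ∑_{S ⊆ [n], |S| ≤ k} (-1)^{k-|S|} binom(n-|S|, k-|S|) tr (M[S]^k)

  traceSum : ∀ {n} → ℕ → Matrix n → Carrier
  traceSum {n} k M =
    ∑[ S ∈ filter (λ S → ∣ S ∣ ℕ.≤? k) (subsets n) ]
      (- 1#) ^ (k ∸ ∣ S ∣) * (((n ∸ ∣ S ∣) C (k ∸ ∣ S ∣)) · tr (M ⟦ S ⟧ ^ᴹ k))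

  ----------------------------------------------------------------------
  -- Weighted multigraphs and their consolidation

  record MultiGraph : Set (Level.suc 0ℓ ⊔ c) where
    field
      size      : ℕ
      Edge      : Set
      edges     : List Edge
      Joins     : Edge → Fin size → Fin size → Set
      joins?    : ∀ e → Decidable (Joins e)
      joins-sym : ∀ {e i j} → Joins e i j → Joins e j i
      wg        : Edge → Carrier

  Loopless : MultiGraph → Set
  Loopless Γ = ∀ {e} → e ∈ edges → ∀ i → ¬ Joins e i i
    where open MultiGraph Γ

  consolidate : (Γ : MultiGraph) → Loopless Γ → Graph (MultiGraph.size Γ)
  consolidate Γ loopless = record
    { Adj     = λ i j → Any (λ e → Joins e i j) edges
    ; adj?    = λ i j → any? (λ e → joins? e i j) edges
    ; irrefl  = λ {i} a → let (_ , e∈ , joins) = find a in loopless e∈ i joins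
    ; adj-sym = Any.map joins-sym
    ; wg      = λ i j → ∏ (filter (λ e → joins? e i j) edges) wg
    ; wg-sym  = λ {i} {j} _ → reflexive (cong (λ es → ∏ es wg)
                  (filter-≐ (λ e → joins? e i j) (λ e → joins? e j i)
                    (joins-sym , joins-sym) edges))
    }
    where open MultiGraph Γ

open Weighted ℤ[w,r] public

------------------------------------------------------------------------
-- Oriented link diagrams, as signed Gauss codes

data Strand : Set where
  over under : Strand

other : Strand → Strand
other over  = under
other under = over

infix 4 _≟ˢ_
_≟ˢ_ : DecidableEquality Strand
over  ≟ˢ over  = yes ≡-refl
over  ≟ˢ under = no λ ()
under ≟ˢ over  = no λ ()
under ≟ˢ under = yes ≡-refl

Crossing : Set
Crossing = ℕ × Sign

Letter : Set
Letter = Crossing × Strand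

-- One cyclic word for each link component, listing its passages through
-- crossings in the direction of travel; an empty word is a crossingless circle.

Code : Set
Code = List (List Letter)

infix 4 _≟ᶜ_ _≟ˡ_
_≟ᶜ_ : DecidableEquality Crossing
_≟ᶜ_ = ≡-dec ℕ._≟_ Sign._≟_

_≟ˡ_ : DecidableEquality Letter
_≟ˡ_ = ≡-dec _≟ᶜ_ _≟ˢ_

crossingsOf : Code → List Crossing
crossingsOf = map proj₁ ∘ concat

-- The association list is read with default x, which is never used for
-- letters of the code at hand.

follow : List (Letter × Letter) → Letter → Letter
follow []             x = x
follow ((a , b) ∷ ab) x with x ≟ˡ a
... | yes _ = b
... | no  _ = follow ab x

next previous : Code → Letter → Letter
next     code = follow (concatMap cyclicPairs code)
previous code = follow (map swap (concatMap cyclicPairs code))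

-- The four half-edges at a crossing. A half-edge also stands for the corner of
-- the diagram lying immediately counterclockwise of it.

data End : Set where
  incoming outgoing : End

infix 4 _≟ᵉ_ _≟ʰ_
_≟ᵉ_ : DecidableEquality End
incoming ≟ᵉ incoming = yes ≡-refl
incoming ≟ᵉ outgoing = no λ ()
outgoing ≟ᵉ incoming = no λ ()
outgoing ≟ᵉ outgoing = yes ≡-refl

HalfEdge : Set
HalfEdge = Letter × End

_≟ʰ_ : DecidableEquality HalfEdge
_≟ʰ_ = ≡-dec _≟ˡ_ _≟ᵉ_

halfEdges : List Crossing → List HalfEdge
halfEdges = concatMap λ c →
  ((c , under) , incoming) ∷ ((c , over) , incoming) ∷
  ((c , under) , outgoing) ∷ ((c , over) , outgoing) ∷ []

opposite-half : Code → HalfEdge → HalfEdge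
opposite-half code (x , outgoing) = next code x , incoming
opposite-half code (x , incoming) = previous code x , outgoing

-- The clockwise neighbour at the same crossing. At a positive crossing the
-- counterclockwise order is: under in, over out, under out, over in.

clockwise : HalfEdge → HalfEdge
clockwise (((c , pos) , under) , incoming) = ((c , pos) , over)  , incoming
clockwise (((c , pos) , over)  , incoming) = ((c , pos) , under) , outgoing
clockwise (((c , pos) , under) , outgoing) = ((c , pos) , over)  , outgoing
clockwise (((c , pos) , over)  , outgoing) = ((c , pos) , under) , incoming
clockwise (((c , neg) , under) , incoming) = ((c , neg) , over)  , outgoing
clockwise (((c , neg) , over)  , outgoing) = ((c , neg) , under) , outgoing
clockwise (((c , neg) , under) , outgoing) = ((c , neg) , over)  , incoming
clockwise (((c , neg) , over)  , incoming) = ((c , neg) , under) , incoming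

-- A region is the list of its corners, met by walking along its boundary with
-- the region on the left. The walk is periodic, and has visited all corners of
-- the region after as many steps as there are half-edges.

module Regions (crossings : List Crossing) (code : Code) where

  Region : Set
  Region = List HalfEdge

  open DecMembership _≟ʰ_ public using (_∈?_)

  regionAt : HalfEdge → Region
  regionAt h =
    iterate (clockwise ∘ opposite-half code) h (length (halfEdges crossings))

  regionsAt : List HalfEdge → List Region
  regionsAt hs = map regionAt (deduplicate (λ h h′ → h′ ∈? regionAt h) hs)

  -- Chains of crossings in which consecutive ones lie on a common component.
  -- A crossing may repeat, so a chain of length k extends to any longer length.

  OnCommonComponent : Crossing → Crossing → Set
  OnCommonComponent a b = Any (λ word → a ∈ map proj₁ word × b ∈ map proj₁ word) code

  Linked : ℕ → Crossing → Crossing → Set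
  Linked zero    a b = a ≡ b
  Linked (suc k) a b = Any (λ e → Linked k a e × OnCommonComponent e b) crossings

  onCommonComponent? : Decidable OnCommonComponent
  onCommonComponent? a b = any? (λ word → a ∈ᶜ? map proj₁ word ×-dec b ∈ᶜ? map proj₁ word) code
    where open DecMembership _≟ᶜ_ renaming (_∈?_ to _∈ᶜ?_)

  linked? : ∀ k → Decidable (Linked k)
  linked? zero    a b = a ≟ᶜ b
  linked? (suc k) a b = any? (λ e → linked? k a e ×-dec onCommonComponent? e b) crossings

  -- One crossing from each connected piece of the diagram that has crossings.

  pieces : List Crossing
  pieces = deduplicate (linked? (length crossings)) crossings

-- A non-empty diagram on the sphere. By Euler's formula (V - E + F = 2 for each
-- connected piece with crossings, where E = 2V) a Gauss code is that of a
-- diagram on the sphere exactly when it satisfies the equation `planar`, in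
-- which each piece has its own sphere.

record Diagram : Set where
  field
    crossings : List Crossing
    code      : Code
    distinct  : Unique (map proj₁ crossings)
    passages  : concat code ↭ concatMap (λ c → (c , over) ∷ (c , under) ∷ []) crossings
    nonEmpty  : code ≢ []
  open Regions crossings code public
  field
    planar    : length (regionsAt (halfEdges crossings))
                  ≡ length crossings ℕ.+ 2 ℕ.* length pieces

------------------------------------------------------------------------
-- Links: diagrams up to Reidemeister moves

-- A code with k holes, and the code obtained by inserting strands (segments of
-- words) in the holes.

Template : ℕ → Set
Template k = List (List (Letter ⊎ Fin k))

fill : ∀ {k} → Vec (List Letter) k → Template k → Code
fill strands = map (concatMap [ [_] , Vec.lookup strands ]′)

-- Two passages in the given order (pos) or in the reverse order (neg).

inOrder : Sign → Letter → Letter → List Letter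
inOrder pos x y = x ∷ y ∷ []
inOrder neg x y = y ∷ x ∷ []

-- The three strands (top, middle, bottom) of a Reidemeister III triangle, with
-- crossings a (top/middle), b (top/bottom), c (middle/bottom). If three directed
-- lines cross with signs εa, εb, εc, then a precedes b on the top line with sign
-- o just if a precedes c on the middle line with sign o εb εc and b precedes c
-- on the bottom line with sign o εa εc.

triangle : Sign → (a b c : Crossing) → Vec (List Letter) 3
triangle o a@(_ , εa) b@(_ , εb) c@(_ , εc) =
  inOrder o                       (a , over)  (b , over)  Vec.∷
  inOrder (o Sign.* εb Sign.* εc) (a , under) (c , over)  Vec.∷
  inOrder (o Sign.* εa Sign.* εc) (b , under) (c , under) Vec.∷ Vec.[]

data LocalMove : ∀ {k} → Vec (List Letter) k → Vec (List Letter) k → Set where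
  R1 : ∀ c s →
       LocalMove (((c , s) ∷ (c , other s) ∷ []) Vec.∷ Vec.[]) ([] Vec.∷ Vec.[])
  R2 : ∀ a b ε o → let a′ = (a , ε) ; b′ = (b , opposite ε) in
       LocalMove (((a′ , over) ∷ (b′ , over) ∷ []) Vec.∷
                  inOrder o (a′ , under) (b′ , under) Vec.∷ Vec.[])
                 ([] Vec.∷ [] Vec.∷ Vec.[])
  R3 : ∀ o a b c → LocalMove (triangle o a b c) (triangle (opposite o) a b c)

data Step : Code → Code → Set where
  reorder : ∀ {K K′} → K ↭ K′ → Step K K′
  rotate  : ∀ u v K → Step ((u ++ v) ∷ K) ((v ++ u) ∷ K)
  relabel : ∀ (f : ℕ → ℕ) → Injective _≡_ _≡_ f → ∀ K →
            Step K (map (map (map₁ (map₁ f))) K)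
  move    : ∀ {k} {s t : Vec (List Letter) k} → LocalMove s t →
            ∀ (T : Template k) → Step (fill s T) (fill t T)

-- An oriented link is given by any one of its diagrams; D and L present the
-- same link when they are connected by moves through diagrams on the sphere.

Link : Set
Link = Diagram

infix 4 _IsDiagramOf_
_IsDiagramOf_ : Diagram → Link → Set
_IsDiagramOf_ = EqClosure (λ D D′ → Step (Diagram.code D) (Diagram.code D′))

Disconnected : Diagram → Set
Disconnected D = ∃₂ λ K K′ → K ≢ [] × K′ ≢ [] × Diagram.code D ↭ K ++ K′
  × Disjoint (crossingsOf K) (crossingsOf K′)

NonSplit : Link → Set
NonSplit L = ¬ (∃[ D ] (D IsDiagramOf L × Disconnected D))

IsAlternating : Diagram → Set
IsAlternating D =
  All (λ (x , y) → proj₂ x ≢ proj₂ y) (concatMap cyclicPairs (Diagram.code D))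

Alternating : Link → Set
Alternating L = ∃[ D ] (D IsDiagramOf L × IsAlternating D)

-- A crossing is nugatory if some region has two opposite corners there.

Nugatory : Diagram → Crossing → Set
Nugatory D c = ∃₂ λ h s →
    ((c , s) , incoming) ∈ regionAt h × ((c , s) , outgoing) ∈ regionAt h
  where open Diagram D

Reduced : Diagram → Set
Reduced D = ∀ {c} → c ∈ Diagram.crossings D → ¬ Nugatory D c

------------------------------------------------------------------------
-- Tait graphs

-- At a crossing, the corners counterclockwise of the two overcrossing
-- half-edges are opposite, as are those counterclockwise of the undercrossing
-- ones. In an alternating diagram all corners of a region are of the same kind,
-- which gives the checkerboard colouring: the local rule for "black" is the
-- choice of a Strand. A connected diagram without crossings is a circle, with
-- one region (without corners) of each colour.

module _ (D : Diagram) where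
  open Diagram D

  colouredRegionsFor : List Crossing → Strand → List Region
  colouredRegionsFor []         s = [ [] ]
  colouredRegionsFor cs@(_ ∷ _) s =
    regionsAt (filter (λ h → proj₂ (proj₁ h) ≟ˢ s) (halfEdges cs))

  colouredRegions : Strand → List Region
  colouredRegions = colouredRegionsFor crossings

  signWeight : Sign → ℤ[w,r].Carrier
  signWeight pos = w
  signWeight neg = r

  taitGraph : Strand → MultiGraph
  taitGraph s = record
    { size      = length (colouredRegions s)
    ; Edge      = Crossing
    ; edges     = crossings
    ; Joins     = λ e i j → Meets e incoming i × Meets e outgoing j
                          ⊎ Meets e incoming j × Meets e outgoing i
    ; joins?    = λ e i j → (meets? e incoming i ×-dec meets? e outgoing j)
                      ⊎-dec (meets? e incoming j ×-dec meets? e outgoing i)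
    ; joins-sym = Sum.swap
    ; wg        = λ (_ , ε) → signWeight ε
    }
    where
    Meets : Crossing → End → Fin (length (colouredRegions s)) → Set
    Meets e end i = ((e , s) , end) ∈ lookup (colouredRegions s) i

    meets? : ∀ e end i → Dec (Meets e end i)
    meets? e end i = ((e , s) , end) ∈? lookup (colouredRegions s) i

  taitGraph-loopless : Reduced D → ∀ s → Loopless (taitGraph s)
  taitGraph-loopless reduced s = go crossings reduced
    where
    go : ∀ cs → (∀ {e} → e ∈ cs → ¬ Nugatory D e) → ∀ {e} → e ∈ cs →
         ∀ i → ¬ ( ((e , s) , incoming) ∈ lookup (colouredRegionsFor cs s) i
                     × ((e , s) , outgoing) ∈ lookup (colouredRegionsFor cs s) i
                   ⊎ ((e , s) , incoming) ∈ lookup (colouredRegionsFor cs s) i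
                     × ((e , s) , outgoing) ∈ lookup (colouredRegionsFor cs s) i)
    go cs@(_ ∷ _) red e∈ i joins =
      let (h , _ , eq) = ∈-map⁻ regionAt (∈-lookup {xs = colouredRegionsFor cs s} i)
          (p , q) = [ (λ m → m) , (λ m → m) ]′ joins
      in red e∈ (h , s , subst (_ ∈_) eq p , subst (_ ∈_) eq q)

infix 4 _IsReducedAlternatingDiagramOf_
record _IsReducedAlternatingDiagramOf_ (D : Diagram) (L : Link) : Set where
  field
    isDiagram   : D IsDiagramOf L
    alternating : IsAlternating D
    reduced     : Reduced D

  -- The consolidated Tait graph of the regions of the given kind.
  consolidatedTaitGraph : ∀ s → Graph (MultiGraph.size (taitGraph D s))
  consolidatedTaitGraph s = consolidate (taitGraph D s) (taitGraph-loopless D reduced s)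

open _IsReducedAlternatingDiagramOf_ public using (consolidatedTaitGraph)

------------------------------------------------------------------------
-- The invariant CWR

-- `black` is the kind of the black regions.

module _ {D : Diagram} {L : Link} (black : Strand) (d : D IsReducedAlternatingDiagramOf L) where

  G*B : Graph _
  G*B = consolidatedTaitGraph d black

  G*W : Graph _
  G*W = consolidatedTaitGraph d (other black)

  diagramCWR : ℕ → ℤ[w,r].Carrier × ℤ[w,r].Carrier
  diagramCWR k = cycleSum G*B k , cycleSum G*W k

infix 4 _≈²_
_≈²_ : (p q : ℤ[w,r].Carrier × ℤ[w,r].Carrier) → Set
(x , y) ≈² (x′ , y′) = x ℤ[w,r].≈ x′ × y ℤ[w,r].≈ y′

-- v is the common value of the pairs computed from the reduced alternating
-- diagrams of L.

IsCWR : Strand → ℕ → Link → ℤ[w,r].Carrier × ℤ[w,r].Carrier → Set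
IsCWR black k L v =
  ∀ {D} (d : D IsReducedAlternatingDiagramOf L) → diagramCWR black d k ≈² v

module Submission where

-- Expand tr (M[S]^k) as a sum over closed walks of length k with all vertices
-- in S. Summing with signs over the S between the support U of a walk and T
-- gives zero unless U = T, so the sum over |T| = k keeps just the closed walks
-- visiting k distinct vertices. These are the traversals of the simple
-- k-cycles, of which each unoriented cycle has 2k since k ≥ 3. Exchanging the
-- two sums instead, each S occurs once for every T ⊇ S with |T| = k, which gives
-- the binomial coefficient.

open import Level using (Level)
open import Algebra.Bundles using (CommutativeRing; Semiring)
import Algebra.Definitions.RawSemiring as RawSemiringDefinitions
import Algebra.Properties.CommutativeSemigroup as CommutativeSemigroupProperties
import Algebra.Properties.Monoid.Sum as MonoidSum
import Algebra.Properties.Ring as RingProperties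
import Algebra.Properties.Semiring.Mult as SemiringMult
import Data.Bool.Properties as Bool
open import Data.Bool.Base using (if_then_else_)
open import Data.Fin.Base using (Fin; zero; suc)
import Data.Fin.Properties as Fin
open import Data.Fin.Subset using (Subset; inside; outside; ∣_∣; ⊥; ⁅_⁆; _∪_; _⊆_)
  renaming (_∈_ to _∈ˢ_; _∉_ to _∉ˢ_)
open import Data.Fin.Subset.Properties
  using (_⊆?_; _∈?_; p⊆q⇒∣p∣≤∣q∣; ∣p∣≤n; ∪-identityˡ; ∣⊥∣≡0; ⊥⊆; x∈p∪q⁻; p⊆p∪q; q⊆p∪q;
         x∈⁅x⁆; x∈⁅y⁆⇒x≡y; ∉⊥)
import Data.Integer.Base as ℤ
import Data.Integer.Properties as ℤ
open import Data.List.Base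
  using (List; []; _∷_; [_]; _++_; _∷ʳ_; map; concatMap; filter; zip; length;
         reverse; take; drop; deduplicate; allFin; cartesianProductWith)
open import Data.List.Membership.Propositional using (_∈_; find)
open import Data.List.Membership.Propositional.Properties
  using (∈-++⁺ˡ; ∈-++⁺ʳ; ∈-++⁻; ∈-applyUpTo⁺; ∈-applyUpTo⁻; ∈-cartesianProductWith⁺;
         ∈-cartesianProductWith⁻; ∈-concatMap⁺; ∈-concatMap⁻; ∈-filter⁺; ∈-filter⁻; ∈-allFin)
open import Data.List.Membership.Propositional.Properties.WithK using (unique∧set⇒bag)
open import Data.List.Properties
  using (++-assoc; ++-identityʳ; take++drop≡id; length-take; unfold-reverse; reverse-++;
         reverse-involutive; length-reverse; length-applyUpTo; length-++; map-tabulate;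
         ∷-injective; ∷-injectiveˡ)
open import Data.List.Relation.Binary.BagAndSetEquality using (∼bag⇒↭)
open import Data.List.Relation.Binary.Disjoint.Propositional using (Disjoint)
open import Data.List.Relation.Binary.Permutation.Propositional as ↭
  using (_↭_; ↭-refl; ↭-sym; ↭-trans; ↭⇒↭ₛ; module PermutationReasoning)
open import Data.List.Relation.Binary.Permutation.Propositional.Properties
  using (All-resp-↭; ∈-resp-↭; ↭-length; ∷↭∷ʳ; ↭-reverse)
import Data.List.Relation.Binary.Permutation.Setoid.Properties as ↭ₛ
open import Data.List.Relation.Unary.All using (All; []; _∷_; all?)
import Data.List.Relation.Unary.All as All
import Data.List.Relation.Unary.All.Properties as All
open import Data.List.Relation.Unary.AllPairs using (AllPairs; []; _∷_)
import Data.List.Relation.Unary.AllPairs as AllPairs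
import Data.List.Relation.Unary.AllPairs.Properties as AllPairs
open import Data.List.Relation.Unary.Any using (here; there)
import Data.List.Relation.Unary.Any as Any
import Data.List.Relation.Unary.Any.Properties as Any
import Data.List.Relation.Unary.Unique.DecPropositional as DecUnique
open import Data.List.Relation.Unary.Unique.Propositional using (Unique)
import Data.List.Relation.Unary.Unique.Propositional.Properties as Unique
open import Data.Nat.Base as ℕ using (ℕ; zero; suc; _∸_; _≤_; _<_; s≤s; z≤n; z<s)
open import Data.Nat.Combinatorics using (_C_; nCk+nC[k+1]≡[n+1]C[k+1])
open import Data.Nat.GeneralisedArithmetic using (fold; fold-+)
import Data.Nat.Properties as ℕ
open import Data.Product.Base using (∃; _×_; _,_; proj₁; proj₂; uncurry) renaming (swap to ×-swap)
open import Data.Rational.Base using (_/_; toℚᵘ)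
import Data.Rational.Base as ℚ
import Data.Rational.Properties as ℚ
open import Data.Rational.Unnormalised.Base using (mkℚᵘ; *≡*)
import Data.Rational.Unnormalised.Base as ℚᵘ
import Data.Rational.Unnormalised.Properties as ℚᵘ
open import Data.Sum.Base using (_⊎_; inj₁; inj₂)
import Data.Vec.Base as Vec
import Data.Vec.Properties as Vec
open import Function.Base using (_∘_; id)
open import Function.Bundles using (mk⇔)
open import Relation.Binary.Core using (Rel)
open import Relation.Binary.Definitions using (Decidable; DecidableEquality)
open import Relation.Binary.PropositionalEquality as ≡
  using (_≡_; _≢_; cong; cong₂; subst; module ≡-Reasoning)
import Relation.Binary.Reasoning.Setoid as SetoidReasoning
open import Relation.Nullary using (¬_; Dec; yes; no; does; contradiction)
open import Relation.Nullary.Decidable using (_×-dec_; ¬?; dec-true; dec-false)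
open import Relation.Unary using (Pred) renaming (Decidable to Decidable₁)

open import Defs hiding
  (∑; ∏; Matrix; tr; _^ᴹ_; _⟦_⟧; Graph; module Graph; adjacencyMatrix; IsSimpleCycle;
   isSimpleCycle?; SameCycle; sameCycle?; unorientedCycles; cycleWeight; cycleSum;
   nestedTraceSum; traceSum; rotate)

-- Only afterwards does it pass to `ℚ[w,r]`, one coefficient at a time. The range of an inner sum
-- (such as S inside T) depends on the outer index, which obstructs exchanging sums. Each such
-- restriction is therefore turned into a factor `𝟙`, equal to 0 or 1, and the sums run over
-- complete lists. An unoriented cycle is a representative kept by `deduplicate`. Counting its
-- traversals thus means showing that the list of all simple closed words is a permutation of the
-- concatenated traversals of the representatives. This requires that being a traversal is an
-- equivalence relation and that the `2k` traversals are pairwise distinct. The second point is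
-- where `k ≥ 3` enters: a word of two letters read backwards is one of its own rotations.

private variable
  a b c ℓ p q : Level
  A : Set a
  B : Set b

-- Traversals of a cyclic word

-- Rotations are handled as iterates of this single step, so that composing them adds exponents.
rotate : List A → List A
rotate []       = []
rotate (x ∷ xs) = xs ∷ʳ x

fold-shift : ∀ (z : A) f m → fold (f z) f m ≡ f (fold z f m)
fold-shift z f zero    = ≡.refl
fold-shift z f (suc m) = cong f (fold-shift z f m)

-- The letters of `us` move to the back one at a time; `vs` is arbitrary because it grows by each
-- letter moved.
fold-rotate-++ : (us vs : List A) → fold (us ++ vs) rotate (length us) ≡ vs ++ us
fold-rotate-++ []       vs = ≡.sym (++-identityʳ vs)
fold-rotate-++ (u ∷ us) vs = begin
  rotate (fold (u ∷ us ++ vs) rotate (length us))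
    ≡⟨ fold-shift (u ∷ us ++ vs) rotate (length us) ⟨
  fold ((us ++ vs) ∷ʳ u) rotate (length us)
    ≡⟨ cong (λ xs → fold xs rotate (length us)) (++-assoc us vs [ u ]) ⟩
  fold (us ++ vs ∷ʳ u) rotate (length us)
    ≡⟨ fold-rotate-++ us (vs ∷ʳ u) ⟩
  (vs ∷ʳ u) ++ us
    ≡⟨ ++-assoc vs [ u ] us ⟩
  vs ++ u ∷ us ∎
  where open ≡-Reasoning

drop++take≡fold-rotate : ∀ i (xs : List A) → i ≤ length xs →
                         drop i xs ++ take i xs ≡ fold xs rotate i
drop++take≡fold-rotate i xs i≤ = begin
  drop i xs ++ take i xs                                    ≡⟨ fold-rotate-++ (take i xs) (drop i xs) ⟨
  fold (take i xs ++ drop i xs) rotate (length (take i xs)) ≡⟨ cong₂ (λ ys → fold ys rotate) (take++drop≡id i xs)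
                                                                 (≡.trans (length-take i xs) (ℕ.m≤n⇒m⊓n≡m i≤)) ⟩
  fold xs rotate i                                          ∎
  where open ≡-Reasoning

fold-rotate-length : (xs : List A) → fold xs rotate (length xs) ≡ xs
fold-rotate-length xs = ≡.trans (cong (λ ys → fold ys rotate (length xs)) (≡.sym (++-identityʳ xs)))
                                (fold-rotate-++ xs [])

fold-rotate-multiple : ∀ i (xs : List A) → fold xs rotate (i ℕ.* length xs) ≡ xs
fold-rotate-multiple zero    xs = ≡.refl
fold-rotate-multiple (suc i) xs = begin
  fold xs rotate (length xs ℕ.+ i ℕ.* length xs)
    ≡⟨ fold-+ xs rotate (length xs) ⟩
  fold (fold xs rotate (i ℕ.* length xs)) rotate (length xs)
    ≡⟨ cong (λ ys → fold ys rotate (length xs)) (fold-rotate-multiple i xs) ⟩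
  fold xs rotate (length xs)
    ≡⟨ fold-rotate-length xs ⟩
  xs ∎
  where open ≡-Reasoning

rotate-↭ : (xs : List A) → rotate xs ↭ xs
rotate-↭ []       = ↭-refl
rotate-↭ (x ∷ xs) = ↭-sym (∷↭∷ʳ x xs)

fold-rotate-↭ : ∀ (xs : List A) i → fold xs rotate i ↭ xs
fold-rotate-↭ xs zero    = ↭-refl
fold-rotate-↭ xs (suc i) = ↭-trans (rotate-↭ (fold xs rotate i)) (fold-rotate-↭ xs i)

-- The dihedral relation: conjugation by reversal inverts a rotation.
rotate-reverse-rotate : (xs : List A) → rotate (reverse (rotate xs)) ≡ reverse xs
rotate-reverse-rotate []       = ≡.refl
rotate-reverse-rotate (x ∷ xs) =
  ≡.trans (cong rotate (reverse-++ xs [ x ])) (≡.sym (unfold-reverse x xs))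

fold-rotate-reverse : ∀ (xs : List A) i →
                      fold (reverse (fold xs rotate i)) rotate i ≡ reverse xs
fold-rotate-reverse xs zero    = ≡.refl
fold-rotate-reverse xs (suc i) = begin
  rotate (fold (reverse (rotate ys)) rotate i)
    ≡⟨ fold-shift (reverse (rotate ys)) rotate i ⟨
  fold (rotate (reverse (rotate ys))) rotate i
    ≡⟨ cong (λ zs → fold zs rotate i) (rotate-reverse-rotate ys) ⟩
  fold (reverse ys) rotate i
    ≡⟨ fold-rotate-reverse xs i ⟩
  reverse xs ∎
  where
  open ≡-Reasoning
  ys = fold xs rotate i

∈-rotations⁻ : {ts xs : List A} → ts ∈ rotations xs → ∃ λ i → ts ≡ fold xs rotate i
∈-rotations⁻ {xs = xs} t∈ with i , i< , eq ← ∈-applyUpTo⁻ (λ i → drop i xs ++ take i xs) t∈ =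
  i , ≡.trans eq (drop++take≡fold-rotate i xs (ℕ.<⇒≤ i<))

-- `rotations xs` lists only exponents below the length, so `reduce` replaces `i` by its remainder,
-- wrapping to zero at each full turn. The empty word has no rotations in this encoding, hence the
-- hypothesis.
fold-rotate∈rotations : ∀ (xs : List A) → 0 < length xs → ∀ i → fold xs rotate i ∈ rotations xs
fold-rotate∈rotations xs 0< i =
  let j , j< , eq = reduce i in subst (_∈ rotations xs)
    (≡.trans (drop++take≡fold-rotate j xs (ℕ.<⇒≤ j<)) (≡.sym eq))
    (∈-applyUpTo⁺ (λ i → drop i xs ++ take i xs) j<)
  where
  reduce : ∀ i → ∃ λ j → j < length xs × fold xs rotate i ≡ fold xs rotate j
  reduce zero    = zero , 0< , ≡.refl
  reduce (suc i) with j , j< , eq ← reduce i with suc j ℕ.<? length xs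
  ... | yes 1+j< = suc j , 1+j< , cong rotate eq
  ... | no  1+j≮ = zero , 0< , ≡.trans (cong rotate eq) (≡.trans
    (cong (fold xs rotate) (ℕ.≤-antisym j< (ℕ.≮⇒≥ 1+j≮))) (fold-rotate-length xs))

rotations⇒↭ : {ts xs : List A} → ts ∈ rotations xs → ts ↭ xs
rotations⇒↭ {xs = xs} t∈ with i , ≡.refl ← ∈-rotations⁻ {xs = xs} t∈ = fold-rotate-↭ xs i

rotations⇒0< : {ts xs : List A} → ts ∈ rotations xs → 0 < length xs
rotations⇒0< {xs = _ ∷ _} _ = z<s

rotations-trans : {ts us xs : List A} → ts ∈ rotations us → us ∈ rotations xs → ts ∈ rotations xs
rotations-trans {xs = xs} t∈ u∈ with j , ≡.refl ← ∈-rotations⁻ {xs = xs} u∈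
                              with i , ≡.refl ← ∈-rotations⁻ {xs = fold xs rotate j} t∈ =
  subst (_∈ rotations xs) (fold-+ xs rotate i)
    (fold-rotate∈rotations xs (rotations⇒0< {xs = xs} u∈) (i ℕ.+ j))

-- For a word of length `L`, rotation by `i` is undone by rotation by `i * (L - 1)`: together they
-- make `i * L` steps, which is `i` full turns. Here `L - 1` is the length of the tail `xs′`.
rotations-sym : {ts xs : List A} → ts ∈ rotations xs → xs ∈ rotations ts
rotations-sym {xs = xs@(_ ∷ xs′)} t∈ with i , ≡.refl ← ∈-rotations⁻ {xs = xs} t∈ =
  subst (_∈ rotations ts) eq (fold-rotate∈rotations ts 0<ts (i ℕ.* length xs′))
  where
  open ≡-Reasoning
  ts = fold xs rotate i

  0<ts : 0 < length ts
  0<ts = subst (0 <_) (≡.sym (↭-length (fold-rotate-↭ xs i))) z<s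

  eq : fold ts rotate (i ℕ.* length xs′) ≡ xs
  eq = begin
    fold ts rotate (i ℕ.* length xs′)
      ≡⟨ fold-+ xs rotate (i ℕ.* length xs′) ⟨
    fold xs rotate (i ℕ.* length xs′ ℕ.+ i)
      ≡⟨ cong (fold xs rotate) (≡.trans (ℕ.+-comm _ i) (≡.sym (ℕ.*-suc i _))) ⟩
    fold xs rotate (i ℕ.* length xs)
      ≡⟨ fold-rotate-multiple i xs ⟩
    xs ∎

-- `fold-rotate-reverse` exhibits `reverse xs` as a rotation of `reverse ts`; symmetry gives the
-- wanted direction.
rotations-reverse : {ts xs : List A} → ts ∈ rotations xs → reverse ts ∈ rotations (reverse xs)
rotations-reverse {ts = ts} {xs} t∈ with i , ≡.refl ← ∈-rotations⁻ {xs = xs} t∈ =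
  rotations-sym (subst (_∈ rotations (reverse ts)) (fold-rotate-reverse xs i)
    (fold-rotate∈rotations (reverse ts) 0<rev i))
  where
  0<rev : 0 < length (reverse ts)
  0<rev = subst (0 <_) (≡.sym (≡.trans (length-reverse ts) (↭-length (fold-rotate-↭ xs i))))
                (rotations⇒0< {xs = xs} t∈)

rotations-reverseˡ : {ts xs : List A} → reverse ts ∈ rotations xs → ts ∈ rotations (reverse xs)
rotations-reverseˡ {ts = ts} t∈ =
  subst (_∈ _) (reverse-involutive ts) (rotations-reverse t∈)

traversals-refl : (xs : List A) → 0 < length xs → xs ∈ traversals xs
traversals-refl xs 0< = ∈-++⁺ˡ (fold-rotate∈rotations xs 0< 0)

traversals-sym : {ts xs : List A} → ts ∈ traversals xs → xs ∈ traversals ts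
traversals-sym {ts = ts} {xs} t∈ with ∈-++⁻ (rotations xs) t∈
... | inj₁ t∈rot = ∈-++⁺ˡ (rotations-sym t∈rot)
... | inj₂ t∈rev = ∈-++⁺ʳ (rotations ts) (rotations-reverseˡ (rotations-sym t∈rev))

traversals-trans : {ts us xs : List A} →
                   ts ∈ traversals us → us ∈ traversals xs → ts ∈ traversals xs
traversals-trans {us = us} {xs} t∈ u∈ with ∈-++⁻ (rotations us) t∈ | ∈-++⁻ (rotations xs) u∈
... | inj₁ p | inj₁ q = ∈-++⁺ˡ (rotations-trans p q)
... | inj₁ p | inj₂ q = ∈-++⁺ʳ (rotations xs) (rotations-trans p q)
... | inj₂ p | inj₁ q = ∈-++⁺ʳ (rotations xs) (rotations-trans p (rotations-reverse q))
... | inj₂ p | inj₂ q = ∈-++⁺ˡ (rotations-trans p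
        (subst (_ ∈_) (cong rotations (reverse-involutive xs)) (rotations-reverse q)))

traversals⇒↭ : {ts xs : List A} → ts ∈ traversals xs → ts ↭ xs
traversals⇒↭ {xs = xs} t∈ with ∈-++⁻ (rotations xs) t∈
... | inj₁ p = rotations⇒↭ p
... | inj₂ p = ↭-trans (rotations⇒↭ p) (↭-reverse xs)

-- Source of the factor `2k`. It counts entries of the list; that they are distinct is
-- `traversals-unique`.
length-traversals : (xs : List A) → length (traversals xs) ≡ 2 ℕ.* length xs
length-traversals xs = begin
  length (rotations xs ++ rotations (reverse xs))
    ≡⟨ length-++ (rotations xs) ⟩
  length (rotations xs) ℕ.+ length (rotations (reverse xs))
    ≡⟨ cong₂ ℕ._+_ (length-applyUpTo _ (length xs)) (length-applyUpTo _ (length (reverse xs))) ⟩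
  length xs ℕ.+ length (reverse xs)
    ≡⟨ cong (length xs ℕ.+_) (≡.trans (length-reverse xs) (≡.sym (ℕ.+-identityʳ _))) ⟩
  2 ℕ.* length xs ∎
  where open ≡-Reasoning

-- A cycle cut open: `cyclicPairs (x ∷ xs)` is `path x xs x` by definition, and independent end
-- points allow inductions that the closed form does not.
path : A → List A → A → List (A × A)
path x vs y = zip (x ∷ vs) (vs ∷ʳ y)

path-++ : ∀ (x : A) us y vs z → path x (us ++ y ∷ vs) z ≡ path x us y ++ path y vs z
path-++ x []       y vs z = ≡.refl
path-++ x (u ∷ us) y vs z = cong ((x , u) ∷_) (path-++ u us y vs z)

path-reverse : ∀ (x : A) vs y → path y (reverse vs) x ↭ map ×-swap (path x vs y)
path-reverse x []       y = ↭-refl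
path-reverse x (v ∷ vs) y = begin
  path y (reverse (v ∷ vs)) x        ≡⟨ cong (λ us → path y us x) (unfold-reverse v vs) ⟩
  path y (reverse vs ∷ʳ v) x         ≡⟨ path-++ y (reverse vs) v [] x ⟩
  path y (reverse vs) v ∷ʳ (v , x)   ↭⟨ ∷↭∷ʳ _ _ ⟨
  (v , x) ∷ path y (reverse vs) v    ↭⟨ ↭.prep _ (path-reverse v vs y) ⟩
  (v , x) ∷ map ×-swap (path v vs y) ∎
  where open PermutationReasoning

cyclicPairs-rotate : (xs : List A) → cyclicPairs (rotate xs) ↭ cyclicPairs xs
cyclicPairs-rotate []           = ↭-refl
cyclicPairs-rotate (x ∷ [])     = ↭-refl
cyclicPairs-rotate (x ∷ y ∷ xs) = begin
  path y (xs ∷ʳ x) y     ≡⟨ path-++ y xs x [] y ⟩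
  path y xs x ∷ʳ (x , y) ↭⟨ ∷↭∷ʳ _ _ ⟨
  path x (y ∷ xs) x      ∎
  where open PermutationReasoning

cyclicPairs-reverse : (xs : List A) → cyclicPairs (reverse xs) ↭ map ×-swap (cyclicPairs xs)
cyclicPairs-reverse []       = ↭-refl
cyclicPairs-reverse (x ∷ xs) = begin
  cyclicPairs (reverse (x ∷ xs))        ≡⟨ cong cyclicPairs (unfold-reverse x xs) ⟩
  cyclicPairs (rotate (x ∷ reverse xs)) ↭⟨ cyclicPairs-rotate (x ∷ reverse xs) ⟩
  path x (reverse xs) x                 ↭⟨ path-reverse x xs x ⟩
  map ×-swap (path x xs x)              ∎
  where open PermutationReasoning

rotations⇒cyclicPairs-↭ : {ts xs : List A} → ts ∈ rotations xs → cyclicPairs ts ↭ cyclicPairs xs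
rotations⇒cyclicPairs-↭ {xs = xs} t∈ with i , ≡.refl ← ∈-rotations⁻ {xs = xs} t∈ = go i
  where
  go : ∀ i → cyclicPairs (fold xs rotate i) ↭ cyclicPairs xs
  go zero    = ↭-refl
  go (suc i) = ↭-trans (cyclicPairs-rotate (fold xs rotate i)) (go i)

traversals⇒cyclicPairs-↭ : {ts xs : List A} → ts ∈ traversals xs →
  cyclicPairs ts ↭ cyclicPairs xs ⊎ cyclicPairs ts ↭ map ×-swap (cyclicPairs xs)
traversals⇒cyclicPairs-↭ {xs = xs} t∈ with ∈-++⁻ (rotations xs) t∈
... | inj₁ p = inj₁ (rotations⇒cyclicPairs-↭ p)
... | inj₂ p = inj₂ (↭-trans (rotations⇒cyclicPairs-↭ p) (cyclicPairs-reverse xs))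

-- Distinctness of the traversals of a word without repetitions

drop-nonEmpty : ∀ i (xs : List A) → i < length xs → ∃ λ y → ∃ λ ys → drop i xs ≡ y ∷ ys × y ∈ xs
drop-nonEmpty zero    (x ∷ xs) _        = x , xs , ≡.refl , here ≡.refl
drop-nonEmpty (suc i) (x ∷ xs) (s≤s i<) =
  let y , ys , eq , y∈ = drop-nonEmpty i xs i< in y , ys , eq , there y∈

-- Different proper suffixes of a word without repetitions already differ in their first letter, so
-- whatever follows them is irrelevant; `us` and `vs` stand for the `take` parts of two rotations.
drop-distinct : ∀ {xs : List A} {i j} us vs → Unique xs → i < j → j < length xs →
                drop i xs ++ us ≢ drop j xs ++ vs
drop-distinct {xs = x ∷ xs} {zero} {suc j} us vs (x∉ ∷ _) _ (s≤s j<) eq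
  with y , ys , drop≡ , y∈ ← drop-nonEmpty j xs j< =
  All.lookup x∉ y∈ (∷-injectiveˡ (≡.trans eq (cong (_++ vs) drop≡)))
drop-distinct {xs = x ∷ xs} {suc i} {suc j} us vs (_ ∷ u) (s≤s i<j) (s≤s j<) =
  drop-distinct us vs u i<j j<

rotations-unique : {xs : List A} → Unique xs → Unique (rotations xs)
rotations-unique {xs = xs} u = Unique.applyUpTo⁺₁ _ (length xs)
  (λ {i} {j} → drop-distinct (take i xs) (take j xs) u)

zip-∈ˡ : ∀ {B : Set p} {xs : List A} {ys : List B} {x y} → (x , y) ∈ zip xs ys → x ∈ xs
zip-∈ˡ {xs = _ ∷ _} {_ ∷ _} (here ≡.refl) = here ≡.refl
zip-∈ˡ {xs = _ ∷ _} {_ ∷ _} (there m)     = there (zip-∈ˡ m)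

-- If xs = x ∷ y ∷ z ∷ … were a rotation of its reverse, (y , x) would be one of
-- its cyclic pairs, but y is followed only by z.

rotations-reverse-disjoint : {xs : List A} → Unique xs → 3 ≤ length xs →
                             Disjoint (rotations xs) (rotations (reverse xs))
rotations-reverse-disjoint {xs = xs@(x ∷ y ∷ z ∷ zs)}
  ((x≢y ∷ x≢z ∷ _) ∷ y∉ ∷ _) _ (t∈ , t∈rev)
  with ∈-resp-↭ (↭-trans (↭-sym (cyclicPairs-reverse xs)) (rotations⇒cyclicPairs-↭
         (rotations-trans (rotations-sym t∈rev) t∈))) (here ≡.refl)
... | here ≡.refl         = x≢y ≡.refl
... | there (here ≡.refl) = x≢z ≡.refl
... | there (there m)     = All.lookup y∉ (zip-∈ˡ m) ≡.refl
rotations-reverse-disjoint {xs = _ ∷ []}     _ (s≤s ())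
rotations-reverse-disjoint {xs = _ ∷ _ ∷ []} _ (s≤s (s≤s ()))

unique-resp-↭ : {xs ys : List A} → xs ↭ ys → Unique xs → Unique ys
unique-resp-↭ p = ↭ₛ.Unique-resp-↭ (≡.setoid _) (↭⇒↭ₛ p)

traversals-unique : {xs : List A} → Unique xs → 3 ≤ length xs → Unique (traversals xs)
traversals-unique {xs = xs} u 3≤ = Unique.++⁺ (rotations-unique u)
  (rotations-unique (unique-resp-↭ (↭-sym (↭-reverse xs)) u)) (rotations-reverse-disjoint u 3≤)

-- Enumeration of words, and representatives of equivalence classes

words-unique : ∀ k {xs : List A} → Unique xs → Unique (words k xs)
words-unique zero    u = [] ∷ []
words-unique (suc k) u = Unique.cartesianProductWith⁺ _∷_ ∷-injective u (words-unique k u)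

∈-words⁺ : ∀ {xs vs : List A} → All (_∈ xs) vs → vs ∈ words (length vs) xs
∈-words⁺ []         = here ≡.refl
∈-words⁺ (v∈ ∷ vs∈) = ∈-cartesianProductWith⁺ _∷_ v∈ (∈-words⁺ vs∈)

∈-words⁻ : ∀ k (xs : List A) {vs} → vs ∈ words k xs → length vs ≡ k
∈-words⁻ zero    xs (here ≡.refl) = ≡.refl
∈-words⁻ (suc k) xs vs∈ with _ , _ , _ , us∈ , ≡.refl ← ∈-cartesianProductWith⁻ _∷_ xs (words k xs) vs∈ =
  cong suc (∈-words⁻ k xs us∈)

module _ {R : Rel A ℓ} (R? : Decidable R) where

  deduplicate-allPairs : ∀ xs → AllPairs (λ x y → ¬ R x y) (deduplicate R? xs)
  deduplicate-allPairs []       = []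
  deduplicate-allPairs (x ∷ xs) =
    All.all-filter (λ y → ¬? (R? x y)) (deduplicate R? xs) ∷
    AllPairs.filter⁺ (λ y → ¬? (R? x y)) (deduplicate-allPairs xs)

  module _ (sym′ : ∀ {x y} → R x y → R y x) (trans′ : ∀ {x y z} → R x y → R y z → R x z)
           (class : A → List A) (∈-class : ∀ {x y} → y ∈ class x → R y x)
           (class-∈ : ∀ {x y} → R y x → y ∈ class x) where

    -- Two lists without repetitions and with the same members are permutations of each other. On
    -- the right, repetitions within a class are excluded by assumption, and across classes because
    -- the representatives are pairwise inequivalent. Reflexivity is asked only on `xs`, as the
    -- empty word is not among its own traversals.
    ↭-concatMap-deduplicate : ∀ {xs} → Unique xs →
      (∀ {x} → x ∈ xs → R x x) → (∀ {x y} → x ∈ xs → R y x → y ∈ xs) →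
      (∀ {x} → x ∈ xs → Unique (class x)) →
      xs ↭ concatMap class (deduplicate R? xs)
    ↭-concatMap-deduplicate {xs} u refl′ closed class-unique =
      ∼bag⇒↭ (unique∧set⇒bag u unique (mk⇔ to from))
      where
      ds = deduplicate R? xs

      to : ∀ {x} → x ∈ xs → x ∈ concatMap class ds
      -- `x` lies in its own class; when an entry is discarded in favour of an equivalent one,
      -- membership in the class carries over.
      to x∈ = ∈-concatMap⁺ class (Any.deduplicate⁺ R?
        (λ r z∈ → class-∈ (trans′ (∈-class z∈) (sym′ r)))
        (Any.map (λ { ≡.refl → class-∈ (refl′ x∈) }) x∈))

      from : ∀ {x} → x ∈ concatMap class ds → x ∈ xs
      from x∈ with d , d∈ , x∈d ← find (∈-concatMap⁻ class {xs = ds} x∈) =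
        closed (Any.deduplicate⁻ R? d∈) (∈-class x∈d)

      unique : Unique (concatMap class ds)
      unique = Unique.concat⁺
        (All.map⁺ (All.tabulate (λ d∈ → class-unique (Any.deduplicate⁻ R? d∈))))
        (AllPairs.map⁺ (AllPairs.map
          (λ ¬r {_} (p , q) → ¬r (trans′ (sym′ (∈-class p)) (∈-class q)))
          (deduplicate-allPairs xs)))

-- Sums over subsets and closed walks

infix 4 _≟ₛ_
_≟ₛ_ : ∀ {n} → DecidableEquality (Subset n)
_≟ₛ_ = Vec.≡-dec Bool._≟_

support : ∀ {n} → List (Fin n) → Subset n
support []       = ⊥
support (x ∷ vs) = ⁅ x ⁆ ∪ support vs

support⊆⇒All : ∀ {n} {S : Subset n} vs → support vs ⊆ S → All (_∈ˢ S) vs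
support⊆⇒All []       _  = []
support⊆⇒All (x ∷ vs) v⊆ = v⊆ (p⊆p∪q _ (x∈⁅x⁆ x)) ∷ support⊆⇒All vs (v⊆ ∘ q⊆p∪q ⁅ x ⁆ _)

All⇒support⊆ : ∀ {n} {S : Subset n} {vs} → All (_∈ˢ S) vs → support vs ⊆ S
All⇒support⊆ [] x∈ = ⊥⊆ x∈
All⇒support⊆ {S = S} {x ∷ vs} (v∈ ∷ vs∈) x∈ with x∈p∪q⁻ ⁅ x ⁆ (support vs) x∈
... | inj₁ y∈ = subst (_∈ˢ S) (≡.sym (x∈⁅y⁆⇒x≡y x y∈)) v∈
... | inj₂ y∈ = All⇒support⊆ vs∈ y∈

∈-support⁺ : ∀ {n} {x : Fin n} {vs} → x ∈ vs → x ∈ˢ support vs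
∈-support⁺ {vs = v ∷ vs} (here ≡.refl) = p⊆p∪q (support vs) (x∈⁅x⁆ v)
∈-support⁺ {vs = v ∷ vs} (there x∈)    = q⊆p∪q ⁅ v ⁆ (support vs) (∈-support⁺ x∈)

∈-support⁻ : ∀ {n} {x : Fin n} vs → x ∈ˢ support vs → x ∈ vs
∈-support⁻ []       x∈ = contradiction x∈ ∉⊥
∈-support⁻ (v ∷ vs) x∈ with x∈p∪q⁻ ⁅ v ⁆ (support vs) x∈
... | inj₁ y∈ = here (x∈⁅y⁆⇒x≡y v y∈)
... | inj₂ y∈ = there (∈-support⁻ vs y∈)

∣⁅x⁆∪U∣-∈ : ∀ {n} (x : Fin n) (U : Subset n) → x ∈ˢ U → ∣ ⁅ x ⁆ ∪ U ∣ ≡ ∣ U ∣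
∣⁅x⁆∪U∣-∈ zero    (inside Vec.∷ U)  _              = cong (suc ∘ ∣_∣) (∪-identityˡ U)
∣⁅x⁆∪U∣-∈ (suc x) (inside Vec.∷ U)  (Vec.there x∈) = cong suc (∣⁅x⁆∪U∣-∈ x U x∈)
∣⁅x⁆∪U∣-∈ (suc x) (outside Vec.∷ U) (Vec.there x∈) = ∣⁅x⁆∪U∣-∈ x U x∈

∣⁅x⁆∪U∣-∉ : ∀ {n} (x : Fin n) (U : Subset n) → x ∉ˢ U → ∣ ⁅ x ⁆ ∪ U ∣ ≡ suc ∣ U ∣
∣⁅x⁆∪U∣-∉ zero    (inside Vec.∷ U)  x∉ = contradiction Vec.here x∉
∣⁅x⁆∪U∣-∉ zero    (outside Vec.∷ U) _  = cong (suc ∘ ∣_∣) (∪-identityˡ U)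
∣⁅x⁆∪U∣-∉ (suc x) (inside Vec.∷ U)  x∉ = cong suc (∣⁅x⁆∪U∣-∉ x U (x∉ ∘ Vec.there))
∣⁅x⁆∪U∣-∉ (suc x) (outside Vec.∷ U) x∉ = ∣⁅x⁆∪U∣-∉ x U (x∉ ∘ Vec.there)

∣support∣≤length : ∀ {n} (vs : List (Fin n)) → ∣ support vs ∣ ≤ length vs
∣support∣≤length {n} []   = ℕ.≤-reflexive (∣⊥∣≡0 n)
∣support∣≤length (v ∷ vs) with v ∈? support vs
... | yes v∈ = ℕ.m≤n⇒m≤1+n (subst (_≤ length vs) (≡.sym (∣⁅x⁆∪U∣-∈ v _ v∈)) (∣support∣≤length vs))
... | no  v∉ = subst (_≤ suc (length vs)) (≡.sym (∣⁅x⁆∪U∣-∉ v _ v∉)) (s≤s (∣support∣≤length vs))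

unique⇒∣support∣≡length : ∀ {n} {vs : List (Fin n)} → Unique vs → ∣ support vs ∣ ≡ length vs
unique⇒∣support∣≡length {n} []                 = ∣⊥∣≡0 n
unique⇒∣support∣≡length {vs = v ∷ vs} (v∉ ∷ u) = ≡.trans
  (∣⁅x⁆∪U∣-∉ v _ (λ v∈ → All.lookup v∉ (∈-support⁻ vs v∈) ≡.refl))
  (cong suc (unique⇒∣support∣≡length u))

-- A letter that recurs later adds nothing to the support, and the remaining letters contribute at
-- most their number, so the size would fall short of the length.
∣support∣≡length⇒unique : ∀ {n} (vs : List (Fin n)) → ∣ support vs ∣ ≡ length vs → Unique vs
∣support∣≡length⇒unique []       _  = []
∣support∣≡length⇒unique (v ∷ vs) eq with v ∈? support vs
... | yes v∈ = contradiction (ℕ.≤-trans (ℕ.≤-reflexive (≡.trans (≡.sym eq) (∣⁅x⁆∪U∣-∈ v _ v∈)))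
                                        (∣support∣≤length vs)) ℕ.1+n≰n
... | no  v∉ = All.tabulate (λ x∈ eq′ → v∉ (∈-support⁺ (subst (_∈ vs) (≡.sym eq′) x∈))) ∷
  ∣support∣≡length⇒unique vs (ℕ.suc-injective (≡.trans (≡.sym (∣⁅x⁆∪U∣-∉ v _ v∉)) eq))

module TraceFormula (R : CommutativeRing c ℓ) where
  open CommutativeRing R hiding (zero)
  open Weighted R
  open SetoidReasoning setoid
  open RawSemiringDefinitions (Semiring.rawSemiring semiring) using (sum; _^_)
    renaming (_×_ to _·_)
  open RingProperties ring using (-1*x≈-x; -‿involutive)
  open MonoidSum +-monoid using (sum-cong-≋)
  open SemiringMult semiring using (×-congʳ; ×-homo-+; ×-assoc-*)
  open CommutativeSemigroupProperties *-commutativeSemigroup using ()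
    renaming (x∙yz≈y∙xz to *-swapˡ; interchange to *-interchange)
  open CommutativeSemigroupProperties (CommutativeRing.+-commutativeSemigroup R) using ()
    renaming (x∙yz≈y∙xz to +-swapˡ; interchange to +-interchange)

  -- Finite sums and products, indicators and signs

  ∑-congᴬ : {f g : A → Carrier} {xs : List A} → All (λ x → f x ≈ g x) xs → ∑ xs f ≈ ∑ xs g
  ∑-congᴬ []         = refl
  ∑-congᴬ (eq ∷ eqs) = +-cong eq (∑-congᴬ eqs)

  ∑-cong : ∀ {f g : A → Carrier} (xs : List A) → (∀ x → f x ≈ g x) → ∑ xs f ≈ ∑ xs g
  ∑-cong xs eq = ∑-congᴬ (All.universal eq xs)

  ∑-zero : ∀ (xs : List A) → ∑ xs (λ _ → 0#) ≈ 0#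
  ∑-zero []       = refl
  ∑-zero (x ∷ xs) = trans (+-identityˡ _) (∑-zero xs)

  ∑-+ : ∀ (xs : List A) (f g : A → Carrier) → ∑ xs (λ x → f x + g x) ≈ ∑ xs f + ∑ xs g
  ∑-+ []       f g = sym (+-identityˡ 0#)
  ∑-+ (x ∷ xs) f g = trans (+-congˡ (∑-+ xs f g)) (+-interchange _ _ _ _)

  ∑-*ˡ : ∀ a (xs : List A) (f : A → Carrier) → ∑ xs (λ x → a * f x) ≈ a * ∑ xs f
  ∑-*ˡ a []       f = sym (zeroʳ a)
  ∑-*ˡ a (x ∷ xs) f = trans (+-congˡ (∑-*ˡ a xs f)) (sym (distribˡ a _ _))

  ∑-*ʳ : ∀ a (xs : List A) (f : A → Carrier) → ∑ xs (λ x → f x * a) ≈ ∑ xs f * a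
  ∑-*ʳ a xs f = trans (∑-cong xs (λ x → *-comm _ a)) (trans (∑-*ˡ a xs f) (*-comm a _))

  ∑-swap : ∀ (xs : List A) (ys : List B) (f : A → B → Carrier) →
           ∑ xs (λ x → ∑ ys (λ y → f x y)) ≈ ∑ ys (λ y → ∑ xs (λ x → f x y))
  ∑-swap []       ys f = sym (∑-zero ys)
  ∑-swap (x ∷ xs) ys f = trans (+-congˡ (∑-swap xs ys f)) (sym (∑-+ ys (f x) _))

  ∑-++ : ∀ (xs : List A) {ys} f → ∑ (xs ++ ys) f ≈ ∑ xs f + ∑ ys f
  ∑-++ []       f = sym (+-identityˡ _)
  ∑-++ (x ∷ xs) f = trans (+-congˡ (∑-++ xs f)) (sym (+-assoc _ _ _))

  ∑-map : ∀ (g : A → B) (xs : List A) f → ∑ (map g xs) f ≡ ∑ xs (f ∘ g)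
  ∑-map g []       f = ≡.refl
  ∑-map g (x ∷ xs) f = cong (f (g x) +_) (∑-map g xs f)

  ∑-concatMap : ∀ (g : A → List B) (xs : List A) f →
                ∑ (concatMap g xs) f ≈ ∑ xs (λ x → ∑ (g x) f)
  ∑-concatMap g []       f = refl
  ∑-concatMap g (x ∷ xs) f = trans (∑-++ (g x) f) (+-congˡ (∑-concatMap g xs f))

  ∑-↭ : ∀ {xs ys : List A} f → xs ↭ ys → ∑ xs f ≈ ∑ ys f
  ∑-↭ f ↭.refl            = refl
  ∑-↭ f (↭.prep x p)      = +-congˡ (∑-↭ f p)
  ∑-↭ f (↭.swap x y p)    = trans (+-congˡ (+-congˡ (∑-↭ f p))) (+-swapˡ _ _ _)
  ∑-↭ f (↭.trans p q)     = trans (∑-↭ f p) (∑-↭ f q)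

  ∏-↭ : ∀ {xs ys : List A} f → xs ↭ ys → ∏ xs f ≈ ∏ ys f
  ∏-↭ f ↭.refl            = refl
  ∏-↭ f (↭.prep x p)      = *-congˡ (∏-↭ f p)
  ∏-↭ f (↭.swap x y p)    = trans (*-congˡ (*-congˡ (∏-↭ f p))) (*-swapˡ _ _ _)
  ∏-↭ f (↭.trans p q)     = trans (∏-↭ f p) (∏-↭ f q)

  ∑-constantᴬ : ∀ {f : A → Carrier} {a xs} → All (λ x → f x ≈ a) xs → ∑ xs f ≈ length xs · a
  ∑-constantᴬ []         = refl
  ∑-constantᴬ (eq ∷ eqs) = +-cong eq (∑-constantᴬ eqs)

  ∑-· : ∀ m (xs : List A) f → ∑ xs (λ x → m · f x) ≈ m · ∑ xs f
  ∑-· zero    xs f = ∑-zero xs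
  ∑-· (suc m) xs f = trans (∑-+ xs f _) (+-congˡ (∑-· m xs f))

  ∑-words : ∀ k (xs : List A) f →
            ∑ (words (suc k) xs) f ≈ ∑ xs (λ x → ∑ (words k xs) (λ vs → f (x ∷ vs)))
  ∑-words k xs f = go xs
    where
    go : ∀ ys → ∑ (cartesianProductWith _∷_ ys (words k xs)) f
              ≈ ∑ ys (λ y → ∑ (words k xs) (λ vs → f (y ∷ vs)))
    go []       = refl
    go (y ∷ ys) = trans (∑-++ (map (y ∷_) (words k xs)) f)
      (+-cong (reflexive (∑-map (y ∷_) (words k xs) f)) (go ys))

  ∑-subsets : ∀ n (f : Subset (suc n) → Carrier) → ∑ (subsets (suc n)) f ≈
    ∑ (subsets n) (λ S → f (outside Vec.∷ S)) + ∑ (subsets n) (λ S → f (inside Vec.∷ S))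
  ∑-subsets n f = trans (∑-++ (map (outside Vec.∷_) (subsets n)) f)
    (+-cong (reflexive (∑-map _ (subsets n) f)) (reflexive (∑-map _ (subsets n) f)))

  ∑-allFin : ∀ {n} f → ∑ (allFin (suc n)) f ≈ f zero + ∑ (allFin n) (f ∘ suc)
  ∑-allFin {n} f = +-congˡ (reflexive (≡.trans (cong (λ xs → ∑ xs f) (≡.sym (map-tabulate id suc)))
                                               (∑-map suc (allFin n) f)))

  𝟙 : {P : Set p} → Dec P → Carrier
  𝟙 P? = if does P? then 1# else 0#

  𝟙-yes : {P : Set p} (P? : Dec P) → P → 𝟙 P? ≈ 1#
  𝟙-yes P? x = reflexive (cong (if_then 1# else 0#) (dec-true P? x))

  𝟙-no : {P : Set p} (P? : Dec P) → ¬ P → 𝟙 P? ≈ 0#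
  𝟙-no P? ¬x = reflexive (cong (if_then 1# else 0#) (dec-false P? ¬x))

  𝟙-cong : {P : Set p} {Q : Set q} (P? : Dec P) (Q? : Dec Q) → (P → Q) → (Q → P) → 𝟙 P? ≈ 𝟙 Q?
  𝟙-cong P? (yes y) to from = 𝟙-yes P? (from y)
  𝟙-cong P? (no ¬y) to from = 𝟙-no P? (¬y ∘ to)

  𝟙-× : {P : Set p} {Q : Set q} (P? : Dec P) (Q? : Dec Q) → 𝟙 (P? ×-dec Q?) ≈ 𝟙 P? * 𝟙 Q?
  𝟙-× (yes _) Q? = sym (*-identityˡ _)
  𝟙-× (no _)  Q? = sym (zeroˡ _)

  -- Makes the condition behind an indicator available as a hypothesis while rewriting the term it
  -- multiplies.
  𝟙-*-cong : {P : Set p} (P? : Dec P) {x y : Carrier} → (P → x ≈ y) → 𝟙 P? * x ≈ 𝟙 P? * y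
  𝟙-*-cong (yes z) eq = *-congˡ (eq z)
  𝟙-*-cong (no _)  eq = trans (zeroˡ _) (sym (zeroˡ _))

  ∑-filter : ∀ {P : Pred A p} (P? : Decidable₁ P) xs f →
             ∑ (filter P? xs) f ≈ ∑ xs (λ x → 𝟙 (P? x) * f x)
  ∑-filter P? []       f = refl
  ∑-filter P? (x ∷ xs) f with P? x
  ... | yes _ = +-cong (sym (*-identityˡ _)) (∑-filter P? xs f)
  ... | no _  = trans (∑-filter P? xs f) (sym (trans (+-congʳ (zeroˡ _)) (+-identityˡ _)))

  *-swapˡ³ : ∀ x y z t → x * (y * (z * t)) ≈ z * (x * (y * t))
  *-swapˡ³ x y z t = trans (*-congˡ (*-swapˡ y z t)) (*-swapˡ x z _)

  -1*-1≈1 : - 1# * - 1# ≈ 1#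
  -1*-1≈1 = trans (-1*x≈-x (- 1#)) (-‿involutive 1#)

  ε : ℕ → Carrier
  ε m = (- 1#) ^ m

  ε-square : ∀ m → ε m * ε m ≈ 1#
  ε-square zero    = *-identityˡ 1#
  ε-square (suc m) = begin
    (- 1# * ε m) * (- 1# * ε m) ≈⟨ *-interchange _ _ _ _ ⟩
    (- 1# * - 1#) * (ε m * ε m) ≈⟨ *-cong -1*-1≈1 (ε-square m) ⟩
    1# * 1#                     ≈⟨ *-identityˡ 1# ⟩
    1#                          ∎

  -- As -1 is its own inverse, the truncated difference splits into two factors: `ε k` can leave a
  -- sum over subsets, and only `ε s` takes part in the cancellation.
  ε-∸ : ∀ {s k} → s ≤ k → ε (k ∸ s) ≈ ε k * ε s
  ε-∸ {k = k} z≤n = sym (*-identityʳ (ε k))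
  ε-∸ {suc s} {suc k} (s≤s s≤k) = begin
    ε (k ∸ s)                   ≈⟨ ε-∸ s≤k ⟩
    ε k * ε s                   ≈⟨ *-identityˡ _ ⟨
    1# * (ε k * ε s)            ≈⟨ *-congʳ -1*-1≈1 ⟨
    (- 1# * - 1#) * (ε k * ε s) ≈⟨ *-interchange _ _ _ _ ⟩
    (- 1# * ε k) * (- 1# * ε s) ∎

  -- Inclusion-exclusion and counting of supersets

  ∑-subsets-zeroʳ : ∀ n {f : Subset (suc n) → Carrier} {x : Carrier} →
    ∑ (subsets n) (λ S → f (outside Vec.∷ S)) ≈ x →
    (∀ S → f (inside Vec.∷ S) ≈ 0#) → ∑ (subsets (suc n)) f ≈ x
  ∑-subsets-zeroʳ n {f} eq z = trans (∑-subsets n f)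
    (trans (+-cong eq (trans (∑-cong (subsets n) z) (∑-zero (subsets n)))) (+-identityʳ _))

  ∑-subsets-zeroˡ : ∀ n {f : Subset (suc n) → Carrier} {x : Carrier} →
    (∀ S → f (outside Vec.∷ S) ≈ 0#) →
    ∑ (subsets n) (λ S → f (inside Vec.∷ S)) ≈ x → ∑ (subsets (suc n)) f ≈ x
  ∑-subsets-zeroˡ n {f} z eq = trans (∑-subsets n f)
    (trans (+-cong (trans (∑-cong (subsets n) z) (∑-zero (subsets n))) eq) (+-identityˡ _))

  𝟙-∷ : ∀ {n} b (U T : Subset n) → 𝟙 ((b Vec.∷ U) ≟ₛ (b Vec.∷ T)) ≈ 𝟙 (U ≟ₛ T)
  𝟙-∷ b U T = 𝟙-cong ((b Vec.∷ U) ≟ₛ (b Vec.∷ T)) (U ≟ₛ T) Vec.∷-injectiveʳ (cong (b Vec.∷_))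

  -- In effect, `subsets n` lists `U` exactly once.
  ∑-≟ : ∀ {n} (U : Subset n) (f : Subset n → Carrier) →
        ∑ (subsets n) (λ T → 𝟙 (U ≟ₛ T) * f T) ≈ f U
  ∑-≟ Vec.[] f = trans (+-identityʳ _) (*-identityˡ _)
  ∑-≟ {suc n} (outside Vec.∷ U) f = ∑-subsets-zeroʳ n
    (trans (∑-cong (subsets n) λ T → *-congʳ (𝟙-∷ outside U T))
           (∑-≟ U (f ∘ (outside Vec.∷_))))
    (λ T → trans (*-congʳ (𝟙-no ((outside Vec.∷ U) ≟ₛ (inside Vec.∷ T)) λ ())) (zeroˡ _))
  ∑-≟ {suc n} (inside Vec.∷ U) f = ∑-subsets-zeroˡ n
    (λ T → trans (*-congʳ (𝟙-no ((inside Vec.∷ U) ≟ₛ (outside Vec.∷ T)) λ ())) (zeroˡ _))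
    (trans (∑-cong (subsets n) λ T → *-congʳ (𝟙-∷ inside U T))
           (∑-≟ U (f ∘ (inside Vec.∷_))))

  -- Coordinate by coordinate: an element of both or of neither of `U` and `T` leaves one choice for
  -- `S`, and an element of `U` outside `T` leaves none. An element of `T` outside `U` may be in `S`
  -- or not, and the two halves of the sum cancel because their signs are opposite.
  alternating : ∀ {n} (U T : Subset n) →
    ∑ (subsets n) (λ S → 𝟙 (U ⊆? S) * (𝟙 (S ⊆? T) * ε ∣ S ∣)) ≈ 𝟙 (U ≟ₛ T) * ε ∣ T ∣
  alternating Vec.[] Vec.[] = trans (+-identityʳ _) (*-congˡ (*-identityˡ _))
  alternating {suc n} (outside Vec.∷ U) (outside Vec.∷ T) = ∑-subsets-zeroʳ n
    (trans (alternating U T) (*-congʳ (sym (𝟙-∷ outside U T))))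
    (λ S → trans (*-congˡ (zeroˡ _)) (zeroʳ _))
  alternating {suc n} (inside Vec.∷ U) (outside Vec.∷ T) = ∑-subsets-zeroˡ n
    (λ S → zeroˡ _)
    (trans (trans (∑-cong (subsets n) λ S → trans (*-congˡ (zeroˡ _)) (zeroʳ _)) (∑-zero (subsets n)))
           (sym (trans (*-congʳ (𝟙-no ((inside Vec.∷ U) ≟ₛ (outside Vec.∷ T)) λ ())) (zeroˡ _))))
  alternating {suc n} (inside Vec.∷ U) (inside Vec.∷ T) = ∑-subsets-zeroˡ n
    (λ S → zeroˡ _)
    (begin
      ∑ (subsets n) (λ S → 𝟙 (U ⊆? S) * (𝟙 (S ⊆? T) * (- 1# * ε ∣ S ∣)))
        ≈⟨ ∑-cong (subsets n) (λ S → *-swapˡ³ _ _ _ _) ⟩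
      ∑ (subsets n) (λ S → - 1# * (𝟙 (U ⊆? S) * (𝟙 (S ⊆? T) * ε ∣ S ∣)))
        ≈⟨ ∑-*ˡ _ (subsets n) _ ⟩
      - 1# * _
        ≈⟨ *-congˡ (alternating U T) ⟩
      - 1# * (𝟙 (U ≟ₛ T) * ε ∣ T ∣)
        ≈⟨ *-swapˡ _ _ _ ⟩
      𝟙 (U ≟ₛ T) * (- 1# * ε ∣ T ∣)
        ≈⟨ *-congʳ (𝟙-∷ inside U T) ⟨
      𝟙 ((inside Vec.∷ U) ≟ₛ (inside Vec.∷ T)) * (- 1# * ε ∣ T ∣) ∎)
  alternating {suc n} (outside Vec.∷ U) (inside Vec.∷ T) = begin
    _
      ≈⟨ ∑-subsets n _ ⟩
    X + ∑ (subsets n) (λ S → 𝟙 (U ⊆? S) * (𝟙 (S ⊆? T) * (- 1# * ε ∣ S ∣)))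
      ≈⟨ +-congˡ (∑-cong (subsets n) (λ S → *-swapˡ³ _ _ _ _)) ⟩
    X + ∑ (subsets n) (λ S → - 1# * (𝟙 (U ⊆? S) * (𝟙 (S ⊆? T) * ε ∣ S ∣)))
      ≈⟨ +-congˡ (∑-*ˡ _ (subsets n) _) ⟩
    X + - 1# * X
      ≈⟨ +-congˡ (-1*x≈-x X) ⟩
    X + - X
      ≈⟨ -‿inverseʳ X ⟩
    0#
      ≈⟨ zeroˡ _ ⟨
    0# * _
      ≈⟨ *-congʳ (𝟙-no ((outside Vec.∷ U) ≟ₛ (inside Vec.∷ T)) λ ()) ⟨
    𝟙 ((outside Vec.∷ U) ≟ₛ (inside Vec.∷ T)) * ε (suc ∣ T ∣) ∎
    where
    X = ∑ (subsets n) (λ S → 𝟙 (U ⊆? S) * (𝟙 (S ⊆? T) * ε ∣ S ∣))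

  -- A coordinate outside `S` may or may not belong to `T`, which is Pascal's rule. Writing the size
  -- of `T` as `∣ S ∣ + j` keeps truncated subtraction out of the induction on the size.
  count-supersets : ∀ {n} (S : Subset n) j →
    ∑ (subsets n) (λ T → 𝟙 (∣ T ∣ ℕ.≟ ∣ S ∣ ℕ.+ j) * 𝟙 (S ⊆? T)) ≈ ((n ∸ ∣ S ∣) C j) · 1#
  count-supersets Vec.[] zero    = +-congʳ (*-identityˡ 1#)
  count-supersets Vec.[] (suc j) = trans (+-identityʳ _) (zeroˡ _)
  count-supersets {suc n} (inside Vec.∷ S) j = ∑-subsets-zeroˡ n (λ T → zeroʳ _)
    (trans (∑-cong (subsets n) λ T →
              *-congʳ (𝟙-cong (suc ∣ T ∣ ℕ.≟ suc (∣ S ∣ ℕ.+ j)) (∣ T ∣ ℕ.≟ ∣ S ∣ ℕ.+ j) ℕ.suc-injective (cong suc)))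
           (count-supersets S j))
  count-supersets {suc n} (outside Vec.∷ S) zero = ∑-subsets-zeroʳ n
    (count-supersets S zero)
    -- With no excess allowed, a superset having one more element would be too large.
    (λ T → trans (*-comm _ _) (trans (𝟙-*-cong (S ⊆? T) {y = 0#} (λ S⊆T →
       𝟙-no (suc ∣ T ∣ ℕ.≟ ∣ S ∣ ℕ.+ 0) λ eq → ℕ.<⇒≱ (ℕ.n<1+n _)
         (subst (_≤ ∣ T ∣) (≡.trans (≡.sym (ℕ.+-identityʳ _)) (≡.sym eq)) (p⊆q⇒∣p∣≤∣q∣ S⊆T)))) (zeroʳ _)))
  count-supersets {suc n} (outside Vec.∷ S) (suc j) = begin
    _                                            ≈⟨ ∑-subsets n _ ⟩
    _                                            ≈⟨ +-cong (count-supersets S (suc j)) (trans (∑-cong (subsets n) λ T →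
      *-congʳ (𝟙-cong (suc ∣ T ∣ ℕ.≟ ∣ S ∣ ℕ.+ suc j) (∣ T ∣ ℕ.≟ ∣ S ∣ ℕ.+ j)
        (λ eq → ℕ.suc-injective (≡.trans eq (ℕ.+-suc _ j))) (λ eq → ≡.trans (cong suc eq) (≡.sym (ℕ.+-suc _ j)))))
      (count-supersets S j)) ⟩
    (m C suc j) · 1# + (m C j) · 1#              ≈⟨ +-comm _ _ ⟩
    (m C j) · 1# + (m C suc j) · 1#              ≈⟨ ×-homo-+ 1# (m C j) (m C suc j) ⟨
    (m C j ℕ.+ m C suc j) · 1#                   ≡⟨ cong (_· 1#) (≡.trans (nCk+nC[k+1]≡[n+1]C[k+1] m j)
                                                     (cong (_C suc j) (≡.sym (ℕ.+-∸-assoc 1 (∣p∣≤n S))))) ⟩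
    ((suc n ∸ ∣ S ∣) C suc j) · 1#               ∎
    where m = n ∸ ∣ S ∣

  -- Powers of principal submatrices as sums over words in all vertices

  ∑-element : ∀ {n} (S : Subset n) (f : Fin n → Carrier) →
              sum (f ∘ element S) ≈ ∑ (allFin n) (λ x → 𝟙 (x ∈? S) * f x)
  ∑-element Vec.[] f = refl
  ∑-element (outside Vec.∷ S) f = begin
    sum (f ∘ suc ∘ element S)
      ≈⟨ ∑-element S (f ∘ suc) ⟩
    ∑ (allFin _) (λ x → 𝟙 (x ∈? S) * f (suc x))
      ≈⟨ +-identityˡ _ ⟨
    0# + ∑ (allFin _) (λ x → 𝟙 (x ∈? S) * f (suc x))
      ≈⟨ +-congʳ (zeroˡ (f zero)) ⟨
    0# * f zero + ∑ (allFin _) (λ x → 𝟙 (x ∈? S) * f (suc x))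
      ≈⟨ ∑-allFin (λ x → 𝟙 (x ∈? (outside Vec.∷ S)) * f x) ⟨
    ∑ (allFin _) (λ x → 𝟙 (x ∈? (outside Vec.∷ S)) * f x) ∎
  ∑-element (inside Vec.∷ S) f = begin
    f zero + sum (f ∘ suc ∘ element S)
      ≈⟨ +-cong (sym (*-identityˡ _)) (∑-element S (f ∘ suc)) ⟩
    1# * f zero + ∑ (allFin _) (λ x → 𝟙 (x ∈? S) * f (suc x))
      ≈⟨ ∑-allFin (λ x → 𝟙 (x ∈? (inside Vec.∷ S)) * f x) ⟨
    ∑ (allFin _) (λ x → 𝟙 (x ∈? (inside Vec.∷ S)) * f x) ∎

  sum-*-zeroʳ : ∀ {n} (f : Fin n → Carrier) → sum (λ i → f i * 0#) ≈ 0#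
  sum-*-zeroʳ {zero}  f = refl
  sum-*-zeroʳ {suc n} f = trans (+-cong (zeroʳ _) (sum-*-zeroʳ (f ∘ suc))) (+-identityˡ 0#)

  sum-*-identity : ∀ {n} (f : Fin n → Carrier) j → sum (λ i → f i * 𝟙 (i Fin.≟ j)) ≈ f j
  sum-*-identity f zero    =
    trans (+-cong (*-identityʳ _) (sum-*-zeroʳ (f ∘ suc))) (+-identityʳ _)
  sum-*-identity f (suc j) =
    trans (+-cong (zeroʳ _) (sum-*-identity (f ∘ suc) j)) (+-identityˡ _)

  𝟙-support : ∀ {n} (S : Subset n) x vs →
              𝟙 (support (x ∷ vs) ⊆? S) ≈ 𝟙 (x ∈? S) * 𝟙 (support vs ⊆? S)
  𝟙-support S x vs = trans
    (𝟙-cong (support (x ∷ vs) ⊆? S) (x ∈? S ×-dec support vs ⊆? S)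
      (λ sub → All.head (support⊆⇒All (x ∷ vs) sub) ,
               All⇒support⊆ (All.tail (support⊆⇒All (x ∷ vs) sub)))
      (λ (x∈ , sub) → All⇒support⊆ (x∈ ∷ support⊆⇒All vs sub)))
    (𝟙-× (x ∈? S) (support vs ⊆? S))

  module _ {n : ℕ} (M : Matrix n) where

    weight : List (Fin n × Fin n) → Carrier
    weight ps = ∏ ps (uncurry M)

    -- Puts a vertex of `S` in front of a walk. It serves both for one more factor in a matrix power
    -- and for the base point of a trace.
    ∑-walks-∷ : ∀ (S : Subset n) m (f : Fin n → List (Fin n) → Carrier) →
      sum (λ l → ∑ (words m (allFin n)) (λ vs → 𝟙 (support vs ⊆? S) * f (element S l) vs)) ≈
      ∑ (allFin n) (λ x → ∑ (words m (allFin n)) (λ vs → 𝟙 (support (x ∷ vs) ⊆? S) * f x vs))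
    ∑-walks-∷ S m f = trans
      (∑-element S (λ x → ∑ (words m (allFin n)) (λ vs → 𝟙 (support vs ⊆? S) * f x vs)))
      (∑-cong (allFin n) λ x → trans (sym (∑-*ˡ (𝟙 (x ∈? S)) (words m (allFin n)) _))
        (∑-cong (words m (allFin n)) λ vs → trans (sym (*-assoc _ _ _)) (*-congʳ (sym (𝟙-support S x vs)))))

    -- A walk of `suc m` steps has `m` interior vertices, and these form `vs`; its ends lie in `S`
    -- already, through `element`, so the indicator concerns the interior alone.
    power-entry : ∀ (S : Subset n) m i j → (M ⟦ S ⟧ ^ᴹ suc m) i j ≈
      ∑ (words m (allFin n)) (λ vs → 𝟙 (support vs ⊆? S) * weight (path (element S i) vs (element S j)))
    power-entry S zero i j = begin
      sum (λ l → (M ⟦ S ⟧) i l * 𝟙 (l Fin.≟ j)) ≈⟨ sum-*-identity ((M ⟦ S ⟧) i) j ⟩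
      (M ⟦ S ⟧) i j                             ≈⟨ *-identityʳ _ ⟨
      (M ⟦ S ⟧) i j * 1#                        ≈⟨ *-identityˡ _ ⟨
      1# * ((M ⟦ S ⟧) i j * 1#)                 ≈⟨ *-congʳ (𝟙-yes (⊥ ⊆? S) ⊥⊆) ⟨
      𝟙 (⊥ ⊆? S) * ((M ⟦ S ⟧) i j * 1#)         ≈⟨ +-identityʳ _ ⟨
      𝟙 (⊥ ⊆? S) * ((M ⟦ S ⟧) i j * 1#) + 0#    ∎
    power-entry S (suc m) i j = begin
      sum (λ l → (M ⟦ S ⟧) i l * (M ⟦ S ⟧ ^ᴹ suc m) l j)
        ≈⟨ sum-cong-≋ (λ l → trans (*-congˡ (power-entry S m l j)) (trans (sym (∑-*ˡ _ (words m (allFin n)) _))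
             (∑-cong (words m (allFin n)) λ vs → *-swapˡ _ _ _))) ⟩
      sum (λ l → ∑ (words m (allFin n)) (λ vs → 𝟙 (support vs ⊆? S) * f (element S l) vs))
        ≈⟨ ∑-walks-∷ S m f ⟩
      ∑ (allFin n) (λ x → ∑ (words m (allFin n)) (λ vs → 𝟙 (support (x ∷ vs) ⊆? S) * f x vs))
        ≈⟨ ∑-words m (allFin n) _ ⟨
      ∑ (words (suc m) (allFin n)) (λ vs → 𝟙 (support vs ⊆? S) * weight (path (element S i) vs (element S j))) ∎
      where
      f : Fin n → List (Fin n) → Carrier
      f x vs = M (element S i) x * weight (path x vs (element S j))

    trace-power : ∀ (S : Subset n) m → tr (M ⟦ S ⟧ ^ᴹ suc m) ≈
      ∑ (words (suc m) (allFin n)) (λ vs → 𝟙 (support vs ⊆? S) * weight (cyclicPairs vs))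
    trace-power S m = begin
      tr (M ⟦ S ⟧ ^ᴹ suc m)
        ≈⟨ sum-cong-≋ (λ i → power-entry S m i i) ⟩
      sum (λ l → ∑ (words m (allFin n)) (λ vs → 𝟙 (support vs ⊆? S) * f (element S l) vs))
        ≈⟨ ∑-walks-∷ S m f ⟩
      ∑ (allFin n) (λ x → ∑ (words m (allFin n)) (λ vs → 𝟙 (support (x ∷ vs) ⊆? S) * f x vs))
        ≈⟨ ∑-words m (allFin n) _ ⟨
      ∑ (words (suc m) (allFin n)) (λ vs → 𝟙 (support vs ⊆? S) * weight (cyclicPairs vs)) ∎
      where
      f : Fin n → List (Fin n) → Carrier
      f x vs = weight (path x vs x)

    -- The two evaluations of the nested sum

    nestedTraceSum≈traceSum : ∀ k → nestedTraceSum k M ≈ traceSum k M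
    nestedTraceSum≈traceSum k = begin
      ∑ Ts (λ T → ∑ (filter (_⊆? T) (subsets n)) g)
        ≈⟨ ∑-cong Ts (λ T → ∑-filter (_⊆? T) (subsets n) g) ⟩
      ∑ Ts (λ T → ∑ (subsets n) (λ S → 𝟙 (S ⊆? T) * g S))
        ≈⟨ ∑-swap Ts (subsets n) _ ⟩
      ∑ (subsets n) (λ S → ∑ Ts (λ T → 𝟙 (S ⊆? T) * g S))
        ≈⟨ ∑-cong (subsets n) (λ S → trans (∑-*ʳ (g S) Ts _)
             (trans (*-congʳ (count S (∣ S ∣ ℕ.≤? k))) (collect S))) ⟩
      ∑ (subsets n) (λ S → 𝟙 (∣ S ∣ ℕ.≤? k) * (ε (k ∸ ∣ S ∣) * (binomial S · tr (M ⟦ S ⟧ ^ᴹ k))))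
        ≈⟨ ∑-filter (λ S → ∣ S ∣ ℕ.≤? k) (subsets n) _ ⟨
      traceSum k M ∎
      where
      Ts = filter (λ T → ∣ T ∣ ℕ.≟ k) (subsets n)

      g : Subset n → Carrier
      g S = ε (k ∸ ∣ S ∣) * tr (M ⟦ S ⟧ ^ᴹ k)

      binomial : Subset n → ℕ
      binomial S = (n ∸ ∣ S ∣) C (k ∸ ∣ S ∣)

      count : ∀ S (s≤k? : Dec (∣ S ∣ ≤ k)) → ∑ Ts (λ T → 𝟙 (S ⊆? T)) ≈ 𝟙 s≤k? * binomial S · 1#
      count S (yes s≤k) = begin
        ∑ Ts (λ T → 𝟙 (S ⊆? T))
          ≈⟨ ∑-filter (λ T → ∣ T ∣ ℕ.≟ k) (subsets n) _ ⟩
        ∑ (subsets n) (λ T → 𝟙 (∣ T ∣ ℕ.≟ k) * 𝟙 (S ⊆? T))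
          ≡⟨ cong (λ m → ∑ (subsets n) (λ T → 𝟙 (∣ T ∣ ℕ.≟ m) * 𝟙 (S ⊆? T))) (ℕ.m+[n∸m]≡n s≤k) ⟨
        ∑ (subsets n) (λ T → 𝟙 (∣ T ∣ ℕ.≟ ∣ S ∣ ℕ.+ (k ∸ ∣ S ∣)) * 𝟙 (S ⊆? T))
          ≈⟨ count-supersets S (k ∸ ∣ S ∣) ⟩
        binomial S · 1#
          ≈⟨ *-identityˡ _ ⟨
        1# * binomial S · 1# ∎
      -- A set with more than `k` elements has no superset of size `k`. The zero must come from the
      -- indicator: truncation makes `k ∸ ∣ S ∣` equal to 0 here, so that `binomial S` is 1.
      count S (no s≰k) = trans
        (trans (∑-congᴬ (All.map (λ {T} |T|≡k → 𝟙-no (S ⊆? T) λ S⊆T →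
                  s≰k (subst (∣ S ∣ ≤_) |T|≡k (p⊆q⇒∣p∣≤∣q∣ S⊆T)))
                (All.all-filter (λ T → ∣ T ∣ ℕ.≟ k) (subsets n)))) (∑-zero Ts))
        (sym (zeroˡ _))

      collect : ∀ S → (𝟙 (∣ S ∣ ℕ.≤? k) * binomial S · 1#) * g S
                    ≈ 𝟙 (∣ S ∣ ℕ.≤? k) * (ε (k ∸ ∣ S ∣) * (binomial S · tr (M ⟦ S ⟧ ^ᴹ k)))
      collect S = trans (*-assoc _ _ _) (*-congˡ (trans (*-swapˡ _ _ _) (*-congˡ
        (trans (×-assoc-* (binomial S) 1# _) (×-congʳ (binomial S) (*-identityˡ _))))))

    -- An identity about arbitrary matrices; the graph enters only later, when the weight of a word
    -- is split into adjacency and edge weights.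
    nestedTraceSum≈∑-unique : ∀ m → nestedTraceSum (suc m) M ≈
      ∑ (words (suc m) (allFin n)) (λ vs → 𝟙 (DecUnique.unique? Fin._≟_ vs) * weight (cyclicPairs vs))
    nestedTraceSum≈∑-unique m = begin
      ∑ Ts (λ T → ∑ (filter (_⊆? T) (subsets n)) g)
        ≈⟨ ∑-congᴬ (All.map (λ {T} → inner T) (All.all-filter (λ T → ∣ T ∣ ℕ.≟ k) (subsets n))) ⟩
      ∑ Ts (λ T → ∑ ws (λ vs → 𝟙 (support vs ≟ₛ T) * W vs))
        ≈⟨ ∑-swap Ts ws _ ⟩
      ∑ ws (λ vs → ∑ Ts (λ T → 𝟙 (support vs ≟ₛ T) * W vs))
        ≈⟨ ∑-congᴬ (All.tabulate (λ {vs} vs∈ → trans (∑-*ʳ (W vs) Ts _) (*-congʳ (outer vs vs∈)))) ⟩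
      ∑ ws (λ vs → 𝟙 (DecUnique.unique? Fin._≟_ vs) * W vs) ∎
      where
      k = suc m
      ws = words k (allFin n)
      Ts = filter (λ T → ∣ T ∣ ℕ.≟ k) (subsets n)

      g : Subset n → Carrier
      g S = ε (k ∸ ∣ S ∣) * tr (M ⟦ S ⟧ ^ᴹ k)

      W : List (Fin n) → Carrier
      W vs = weight (cyclicPairs vs)

      inner : ∀ T → ∣ T ∣ ≡ k →
        ∑ (filter (_⊆? T) (subsets n)) g ≈ ∑ ws (λ vs → 𝟙 (support vs ≟ₛ T) * W vs)
      inner T |T|≡k = begin
        ∑ (filter (_⊆? T) (subsets n)) g
          ≈⟨ ∑-filter (_⊆? T) (subsets n) g ⟩
        ∑ (subsets n) (λ S → 𝟙 (S ⊆? T) * g S)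
          ≈⟨ ∑-cong (subsets n) (λ S → 𝟙-*-cong (S ⊆? T) λ S⊆T → *-cong
               (ε-∸ (subst (∣ S ∣ ≤_) |T|≡k (p⊆q⇒∣p∣≤∣q∣ S⊆T))) (trace-power S m)) ⟩
        ∑ (subsets n) (λ S → 𝟙 (S ⊆? T) * ((ε k * ε ∣ S ∣) * ∑ ws (λ vs → 𝟙 (support vs ⊆? S) * W vs)))
          ≈⟨ ∑-cong (subsets n) (λ S → trans (sym (*-assoc _ _ _)) (trans (sym (∑-*ˡ _ ws _))
               (∑-cong ws (λ vs → rearrange _ _ _ _ _)))) ⟩
        ∑ (subsets n) (λ S → ∑ ws (λ vs → (ε k * W vs) * (𝟙 (support vs ⊆? S) * (𝟙 (S ⊆? T) * ε ∣ S ∣))))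
          ≈⟨ ∑-swap (subsets n) ws _ ⟩
        ∑ ws (λ vs → ∑ (subsets n) (λ S → (ε k * W vs) * (𝟙 (support vs ⊆? S) * (𝟙 (S ⊆? T) * ε ∣ S ∣))))
          ≈⟨ ∑-cong ws (λ vs → trans (∑-*ˡ (ε k * W vs) (subsets n) _) (*-congˡ (alternating (support vs) T))) ⟩
        ∑ ws (λ vs → (ε k * W vs) * (𝟙 (support vs ≟ₛ T) * ε ∣ T ∣))
          ≈⟨ ∑-cong ws (λ vs → cancel _ _) ⟩
        ∑ ws (λ vs → 𝟙 (support vs ≟ₛ T) * W vs) ∎
        where
        rearrange : ∀ x e s y z → (x * (e * s)) * (y * z) ≈ (e * z) * (y * (x * s))
        rearrange x e s y z = begin
          (x * (e * s)) * (y * z) ≈⟨ *-congʳ (*-swapˡ x e s) ⟩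
          (e * (x * s)) * (y * z) ≈⟨ *-congˡ (*-comm y z) ⟩
          (e * (x * s)) * (z * y) ≈⟨ *-interchange _ _ _ _ ⟩
          (e * z) * ((x * s) * y) ≈⟨ *-congˡ (*-comm _ _) ⟩
          (e * z) * (y * (x * s)) ∎

        cancel : ∀ y z → (ε k * z) * (y * ε ∣ T ∣) ≈ y * z
        cancel y z = begin
          (ε k * z) * (y * ε ∣ T ∣) ≈⟨ *-cong (refl {ε k * z}) (*-comm _ _) ⟩
          (ε k * z) * (ε ∣ T ∣ * y) ≈⟨ *-interchange _ _ _ _ ⟩
          (ε k * ε ∣ T ∣) * (z * y) ≡⟨ cong (λ t → (ε k * ε t) * (z * y)) |T|≡k ⟩
          -- Only S = T has survived, and its sign is (-1) to the power `k - k`.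
          (ε k * ε k) * (z * y)     ≈⟨ *-cong (ε-square k) (*-comm z y) ⟩
          1# * (y * z)              ≈⟨ *-identityˡ _ ⟩
          y * z                     ∎

      -- Only `T = support vs` counts, and it has `k` elements exactly when the `k` letters of `vs`
      -- are distinct.
      outer : ∀ vs → vs ∈ ws → ∑ Ts (λ T → 𝟙 (support vs ≟ₛ T)) ≈ 𝟙 (DecUnique.unique? Fin._≟_ vs)
      outer vs vs∈ = begin
        ∑ Ts (λ T → 𝟙 (support vs ≟ₛ T))
          ≈⟨ ∑-filter (λ T → ∣ T ∣ ℕ.≟ k) (subsets n) _ ⟩
        ∑ (subsets n) (λ T → 𝟙 (∣ T ∣ ℕ.≟ k) * 𝟙 (support vs ≟ₛ T))
          ≈⟨ ∑-cong (subsets n) (λ T → *-comm _ _) ⟩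
        ∑ (subsets n) (λ T → 𝟙 (support vs ≟ₛ T) * 𝟙 (∣ T ∣ ℕ.≟ k))
          ≈⟨ ∑-≟ (support vs) (λ T → 𝟙 (∣ T ∣ ℕ.≟ k)) ⟩
        𝟙 (∣ support vs ∣ ℕ.≟ k)
          ≈⟨ 𝟙-cong (∣ support vs ∣ ℕ.≟ k) (DecUnique.unique? Fin._≟_ vs)
               (λ eq → ∣support∣≡length⇒unique vs (≡.trans eq (≡.sym length≡k)))
               (λ u → ≡.trans (unique⇒∣support∣≡length u) length≡k) ⟩
        𝟙 (DecUnique.unique? Fin._≟_ vs) ∎
        where
        length≡k = ∈-words⁻ k (allFin n) vs∈

  -- Simple cycles of a weighted graph and their traversals

  module _ {n : ℕ} (G : Graph n) where
    open Graph G

    -- One step that is not an edge annihilates the product. The resulting indicator, joined to that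
    -- of distinctness, makes up `isSimpleCycle?`.
    weight-adjacencyMatrix : ∀ ps → weight (adjacencyMatrix G) ps ≈
                             𝟙 (all? (uncurry adj?) ps) * ∏ ps (uncurry wg)
    weight-adjacencyMatrix []             = sym (*-identityˡ 1#)
    weight-adjacencyMatrix ((i , j) ∷ ps) = begin
      (if does (adj? i j) then wg i j else 0#) * weight (adjacencyMatrix G) ps
        ≈⟨ *-cong (entry (adj? i j)) (weight-adjacencyMatrix ps) ⟩
      (𝟙 (adj? i j) * wg i j) * (𝟙 (all? (uncurry adj?) ps) * ∏ ps (uncurry wg))
        ≈⟨ *-interchange _ _ _ _ ⟩
      (𝟙 (adj? i j) * 𝟙 (all? (uncurry adj?) ps)) * ∏ ((i , j) ∷ ps) (uncurry wg)
        ≈⟨ *-congʳ (𝟙-× (adj? i j) (all? (uncurry adj?) ps)) ⟨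
      𝟙 (all? (uncurry adj?) ((i , j) ∷ ps)) * ∏ ((i , j) ∷ ps) (uncurry wg) ∎
      where
      entry : ∀ {P : Set} {x} (P? : Dec P) → (if does P? then x else 0#) ≈ 𝟙 P? * x
      entry (yes _) = sym (*-identityˡ _)
      entry (no _)  = sym (zeroˡ _)

    cycles : ℕ → List (List (Fin n))
    cycles k = filter (isSimpleCycle? G) (words k (allFin n))

    -- `wg` is symmetric on edges only, hence the adjacency hypothesis.
    ∏-swap : ∀ {ps} → All (uncurry Adj) ps → ∏ (map ×-swap ps) (uncurry wg) ≈ ∏ ps (uncurry wg)
    ∏-swap []       = refl
    ∏-swap (a ∷ as) = *-cong (sym (wg-sym a)) (∏-swap as)

    sameCycle-weight : ∀ {us vs} → IsSimpleCycle G vs → us ∈ traversals vs →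
                       cycleWeight G us ≈ cycleWeight G vs
    sameCycle-weight {vs = vs} (_ , adj) us∈ with traversals⇒cyclicPairs-↭ {xs = vs} us∈
    ... | inj₁ p = ∏-↭ (uncurry wg) p
    ... | inj₂ p = trans (∏-↭ (uncurry wg) p) (∏-swap {cyclicPairs vs} adj)

    sameCycle-isSimpleCycle : ∀ {us vs} → IsSimpleCycle G vs → us ∈ traversals vs →
                              IsSimpleCycle G us
    sameCycle-isSimpleCycle {vs = vs} (u , adj) us∈ =
      unique-resp-↭ (↭-sym (traversals⇒↭ {xs = vs} us∈)) u ,
      adj′ (traversals⇒cyclicPairs-↭ {xs = vs} us∈)
      where
      adj′ : _ → All (uncurry Adj) _
      adj′ (inj₁ p) = All-resp-↭ (↭-sym p) adj
      adj′ (inj₂ p) = All-resp-↭ (↭-sym p) (All.map⁺ (All.map adj-sym adj))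

    ∑-cycles : ∀ k → 3 ≤ k → ∑ (cycles k) (cycleWeight G) ≈ (2 ℕ.* k) · cycleSum G k
    ∑-cycles k 3≤k = begin
      ∑ (cycles k) (cycleWeight G)
        ≈⟨ ∑-↭ (cycleWeight G) partition ⟩
      ∑ (concatMap traversals (unorientedCycles G k)) (cycleWeight G)
        ≈⟨ ∑-concatMap traversals (unorientedCycles G k) (cycleWeight G) ⟩
      ∑ (unorientedCycles G k) (λ vs → ∑ (traversals vs) (cycleWeight G))
        -- What holds for all simple closed words holds for the representatives kept among them.
        ≈⟨ ∑-congᴬ (All.deduplicate⁺ (sameCycle? G) {xs = cycles k} (All.tabulate class-sum)) ⟩
      ∑ (unorientedCycles G k) (λ vs → (2 ℕ.* k) · cycleWeight G vs)
        ≈⟨ ∑-· (2 ℕ.* k) (unorientedCycles G k) (cycleWeight G) ⟩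
      (2 ℕ.* k) · cycleSum G k ∎
      where
      cycle : ∀ {vs} → vs ∈ cycles k → length vs ≡ k × IsSimpleCycle G vs
      cycle vs∈ with ∈ws , simple ← ∈-filter⁻ (isSimpleCycle? G) {xs = words k (allFin n)} vs∈ =
        ∈-words⁻ k (allFin n) ∈ws , simple

      class-sum : ∀ {vs} → vs ∈ cycles k →
                  ∑ (traversals vs) (cycleWeight G) ≈ (2 ℕ.* k) · cycleWeight G vs
      class-sum {vs} vs∈ with length≡k , simple ← cycle vs∈ = trans
        (∑-constantᴬ (All.tabulate (sameCycle-weight simple)))
        (reflexive (cong (_· cycleWeight G vs) (≡.trans (length-traversals vs) (cong (2 ℕ.*_) length≡k))))

      closed : ∀ {us vs} → us ∈ cycles k → vs ∈ traversals us → vs ∈ cycles k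
      closed {us} {vs} us∈ vs∈ with length≡k , simple ← cycle us∈ = ∈-filter⁺ (isSimpleCycle? G)
        (subst (λ m → vs ∈ words m (allFin n)) (≡.trans (↭-length (traversals⇒↭ {xs = us} vs∈)) length≡k)
          (∈-words⁺ (All.universal ∈-allFin vs)))
        (sameCycle-isSimpleCycle simple vs∈)

      partition : cycles k ↭ concatMap traversals (unorientedCycles G k)
      partition = ↭-concatMap-deduplicate (sameCycle? G)
        (λ {us} {vs} → traversals-sym {ts = us} {vs})
        (λ {us} {vs} {xs} → traversals-trans {ts = us} {vs} {xs})
        traversals id id
        (Unique.filter⁺ (isSimpleCycle? G) (words-unique k (Unique.allFin⁺ n)))
        (λ {vs} vs∈ → traversals-refl vs (ℕ.<-≤-trans ℕ.z<s (3≤ vs∈)))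
        closed
        (λ vs∈ → traversals-unique (proj₁ (proj₂ (cycle vs∈))) (3≤ vs∈))
        where
        3≤ : ∀ {vs} → vs ∈ cycles k → 3 ≤ length vs
        3≤ vs∈ = subst (3 ≤_) (≡.sym (proj₁ (cycle vs∈))) 3≤k

    nestedTraceSum≈cycleSum : ∀ k → 3 ≤ k →
      nestedTraceSum k (adjacencyMatrix G) ≈ (2 ℕ.* k) · cycleSum G k
    nestedTraceSum≈cycleSum k@(suc m) 3≤k = begin
      nestedTraceSum k (adjacencyMatrix G)
        ≈⟨ nestedTraceSum≈∑-unique (adjacencyMatrix G) m ⟩
      ∑ ws (λ vs → 𝟙 (unique? vs) * weight (adjacencyMatrix G) (cyclicPairs vs))
        ≈⟨ ∑-cong ws (λ vs → trans (*-congˡ (weight-adjacencyMatrix (cyclicPairs vs)))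
             (trans (sym (*-assoc _ _ _))
               (*-congʳ (sym (𝟙-× (unique? vs) (all? (uncurry adj?) (cyclicPairs vs))))))) ⟩
      ∑ ws (λ vs → 𝟙 (isSimpleCycle? G vs) * cycleWeight G vs)
        ≈⟨ ∑-filter (isSimpleCycle? G) ws (cycleWeight G) ⟨
      ∑ (cycles k) (cycleWeight G)
        ≈⟨ ∑-cycles k 3≤k ⟩
      (2 ℕ.* k) · cycleSum G k ∎
      where
      open DecUnique Fin._≟_ using (unique?)
      ws = words k (allFin n)

-- Coefficients of polynomials in w and r

module _ (K : CommutativeRing c ℓ) where
  open CommutativeRing K
  open Polynomials K
  open RawSemiringDefinitions (Semiring.rawSemiring semiring) using () renaming (_×_ to _·_)
  open RawSemiringDefinitions
    (Semiring.rawSemiring (CommutativeRing.semiring commutativeRing))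
    using () renaming (_×_ to _·ₚ_)

  coeff-· : ∀ m p n → coeff (m ·ₚ p) n ≈ m · coeff p n
  coeff-· zero    p n = refl
  coeff-· (suc m) p n = trans (coeff-+ p (m ·ₚ p) n) (+-congˡ (coeff-· m p n))

  coeff-constant-* : ∀ a p n → coeff (constant a *ₚ p) n ≈ a * coeff p n
  coeff-constant-* a p n = trans (coeff-+ (scale a p) (0# ∷ []) n)
    (trans (+-cong (coeff-scale a p n) (coeff-0∷[] n)) (+-identityʳ _))
    where
    coeff-0∷[] : ∀ n → coeff (0# ∷ []) n ≈ 0#
    coeff-0∷[] zero    = refl
    coeff-0∷[] (suc n) = refl

-- Coefficients past the end of a list are zero by default, hence the condition on `f`.
coeff-map : ∀ (K : CommutativeRing a ℓ) (L : CommutativeRing b ℓ) →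
  let module K = CommutativeRing K ; module L = CommutativeRing L in
  (f : K.Carrier → L.Carrier) → f K.0# ≡ L.0# →
  ∀ p n → Polynomials.coeff L (map f p) n ≡ f (Polynomials.coeff K p n)
coeff-map K L f f0≡0 []      n       = ≡.sym f0≡0
coeff-map K L f f0≡0 (x ∷ p) zero    = ≡.refl
coeff-map K L f f0≡0 (x ∷ p) (suc n) = coeff-map K L f f0≡0 p n

module ℤ[w]-[r] = Polynomials (Polynomials.commutativeRing ℤ.+-*-commutativeRing)
module ℚ[w]-[r] = Polynomials (Polynomials.commutativeRing ℚ.+-*-commutativeRing)
module ℤ-[w] = Polynomials ℤ.+-*-commutativeRing
module ℚ-[w] = Polynomials ℚ.+-*-commutativeRing

coeff-ι : ∀ p i j → ℚ-[w].coeff (ℚ[w]-[r].coeff (ι p) i) j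
                  ≡ ℤ-[w].coeff (ℤ[w]-[r].coeff p i) j / 1
coeff-ι p i j = ≡.trans
  (cong (λ c → ℚ-[w].coeff c j) (coeff-map (Polynomials.commutativeRing ℤ.+-*-commutativeRing)
    (Polynomials.commutativeRing ℚ.+-*-commutativeRing) (map (_/ 1)) ≡.refl p i))
  (coeff-map ℤ.+-*-commutativeRing ℚ.+-*-commutativeRing (_/ 1) ≡.refl (ℤ[w]-[r].coeff p i) j)

ι-cong : ∀ {p q} → p ℤ[w,r].≈ q → ι p ℚ[w,r].≈ ι q
ι-cong {p} {q} p≈q = Polynomials.coeffwise λ i → Polynomials.coeffwise λ j → ≡.trans (coeff-ι p i j)
  (≡.trans (cong (_/ 1) (ℤ-[w].at (ℤ[w]-[r].at p≈q i) j)) (≡.sym (coeff-ι q i j)))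

-- Normalisation of fractions in `ℚ` blocks direct computation; in unnormalised rationals equality
-- is cross-multiplication.
1/n*n/1 : ∀ m i → (ℤ.+ 1 / suc m) ℚ.* (ℤ.+ suc m ℤ.* i / 1) ≡ i / 1
1/n*n/1 m i = ℚ.toℚᵘ-injective (begin
  toℚᵘ ((ℤ.+ 1 / suc m) ℚ.* (ℤ.+ suc m ℤ.* i / 1))
    ≈⟨ ℚ.toℚᵘ-homo-* (ℤ.+ 1 / suc m) (ℤ.+ suc m ℤ.* i / 1) ⟩
  toℚᵘ (ℤ.+ 1 / suc m) ℚᵘ.* toℚᵘ (ℤ.+ suc m ℤ.* i / 1)
    ≈⟨ ℚᵘ.*-cong (ℚ.toℚᵘ-fromℚᵘ (mkℚᵘ (ℤ.+ 1) m)) (ℚ.toℚᵘ-fromℚᵘ (mkℚᵘ (ℤ.+ suc m ℤ.* i) 0)) ⟩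
  mkℚᵘ (ℤ.+ 1) m ℚᵘ.* mkℚᵘ (ℤ.+ suc m ℤ.* i) 0
    ≈⟨ *≡* cross ⟩
  mkℚᵘ i 0
    ≈⟨ ℚ.toℚᵘ-fromℚᵘ (mkℚᵘ i 0) ⟨
  toℚᵘ (i / 1) ∎)
  where
  open SetoidReasoning ℚᵘ.≃-setoid

  cross : (ℤ.+ 1 ℤ.* (ℤ.+ suc m ℤ.* i)) ℤ.* ℤ.+ 1 ≡ i ℤ.* ℤ.+ (suc m ℕ.* 1)
  cross = ≡.trans (ℤ.*-identityʳ _) (≡.trans (ℤ.*-identityˡ _) (≡.trans (ℤ.*-comm (ℤ.+ suc m) i)
    (cong (λ t → i ℤ.* ℤ.+ t) (≡.sym (ℕ.*-identityʳ (suc m))))))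

module _ where
  open RawSemiringDefinitions (Semiring.rawSemiring ℤ[w,r].semiring) using () renaming (_×_ to _·_)
  open RawSemiringDefinitions
    (Semiring.rawSemiring (CommutativeRing.semiring ℤ.+-*-commutativeRing)) using ()
    renaming (_×_ to _·ℤ_)

  ·ℤ≡* : ∀ m i → m ·ℤ i ≡ ℤ.+ m ℤ.* i
  ·ℤ≡* zero    i = ≡.refl
  ·ℤ≡* (suc m) i = ≡.trans (cong (ℤ._+_ i) (·ℤ≡* m i)) (≡.sym (ℤ.suc-* (ℤ.+ m) i))

  -- Equality in the polynomial rings is equality of all coefficients, and both `ι` and
  -- multiplication by a scalar act on each coefficient separately, so the division takes place in
  -- `ℚ`.
  ι-divide : ∀ m p {q} → q ℤ[w,r].≈ suc m · p → ι p ℚ[w,r].≈ scalar (ℤ.+ 1 / suc m) ℚ[w,r].* ι q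
  ι-divide m p {q} q≈ = Polynomials.coeffwise λ i → Polynomials.coeffwise λ j → ≡.sym (begin
    ℚ-[w].coeff (ℚ[w]-[r].coeff (scalar s ℚ[w,r].* ι q) i) j
      ≡⟨ ℚ-[w].at (coeff-constant-* (Polynomials.commutativeRing ℚ.+-*-commutativeRing)
           (ℚ-[w].constant s) (ι q) i) j ⟩
    ℚ-[w].coeff (ℚ-[w].constant s ℚ-[w].*ₚ ℚ[w]-[r].coeff (ι q) i) j
      ≡⟨ coeff-constant-* ℚ.+-*-commutativeRing s (ℚ[w]-[r].coeff (ι q) i) j ⟩
    s ℚ.* ℚ-[w].coeff (ℚ[w]-[r].coeff (ι q) i) j
      ≡⟨ cong (s ℚ.*_) (coeff-ι q i j) ⟩
    s ℚ.* (ℤ-[w].coeff (ℤ[w]-[r].coeff q i) j / 1)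
      ≡⟨ cong (λ c → s ℚ.* (c / 1)) (multiple i j) ⟩
    s ℚ.* (ℤ.+ suc m ℤ.* ℤ-[w].coeff (ℤ[w]-[r].coeff p i) j / 1)
      ≡⟨ 1/n*n/1 m (ℤ-[w].coeff (ℤ[w]-[r].coeff p i) j) ⟩
    ℤ-[w].coeff (ℤ[w]-[r].coeff p i) j / 1
      ≡⟨ coeff-ι p i j ⟨
    ℚ-[w].coeff (ℚ[w]-[r].coeff (ι p) i) j ∎)
    where
    open ≡-Reasoning
    s = ℤ.+ 1 / suc m

    multiple : ∀ i j → ℤ-[w].coeff (ℤ[w]-[r].coeff q i) j
                     ≡ ℤ.+ suc m ℤ.* ℤ-[w].coeff (ℤ[w]-[r].coeff p i) j
    multiple i j = ≡.trans (ℤ-[w].at (ℤ[w]-[r].at q≈ i) j) (≡.trans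
      (ℤ-[w].at (coeff-· (Polynomials.commutativeRing ℤ.+-*-commutativeRing) (suc m) p i) j)
      (≡.trans (coeff-· ℤ.+-*-commutativeRing (suc m) (ℤ[w]-[r].coeff p i) j) (·ℤ≡* (suc m) _)))

-- The formula over `ℚ[w,r]` and its application to Tait graphs

open import Defs using (Graph; adjacencyMatrix; cycleSum; nestedTraceSum; traceSum)

cycleSum≈nestedTraceSum : ∀ {n} (G : Graph n) k (3≤k : 3 ≤ k) →
  ι (cycleSum G k) ℚ[w,r].≈ scalar (1/2* k 3≤k) ℚ[w,r].* ι (nestedTraceSum k (adjacencyMatrix G))
cycleSum≈nestedTraceSum G (suc k) 3≤k@(s≤s _) =
  -- `ι-divide` expects a predecessor: `2 * suc k` computes to `suc (k + 1 * suc k)`.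
  ι-divide (k ℕ.+ 1 ℕ.* suc k) (cycleSum G (suc k))
    (TraceFormula.nestedTraceSum≈cycleSum ℤ[w,r] G (suc k) 3≤k)

scaled-nestedTraceSum≈traceSum : ∀ {n} (G : Graph n) k (3≤k : 3 ≤ k) →
  scalar (1/2* k 3≤k) ℚ[w,r].* ι (nestedTraceSum k (adjacencyMatrix G))
    ℚ[w,r].≈ scalar (1/2* k 3≤k) ℚ[w,r].* ι (traceSum k (adjacencyMatrix G))
scaled-nestedTraceSum≈traceSum G k 3≤k = ℚ[w,r].*-congˡ {scalar (1/2* k 3≤k)}
  (ι-cong (TraceFormula.nestedTraceSum≈traceSum ℤ[w,r] (adjacencyMatrix G) k))

cycleSum≈traceSum : ∀ {n} (G : Graph n) k (3≤k : 3 ≤ k) →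
  ι (cycleSum G k) ℚ[w,r].≈ scalar (1/2* k 3≤k) ℚ[w,r].* ι (traceSum k (adjacencyMatrix G))
cycleSum≈traceSum G k 3≤k =
  ℚ[w,r].trans (cycleSum≈nestedTraceSum G k 3≤k) (scaled-nestedTraceSum≈traceSum G k 3≤k)

theorem5p4 :
  (∀ (n : ℕ) (G : Graph n) (k : ℕ) (3≤k : 3 ≤ k) →
      let M = adjacencyMatrix G in
      ι (cycleSum G k) ℚ[w,r].≈ scalar (1/2* k 3≤k) ℚ[w,r].* ι (nestedTraceSum k M)
    × scalar (1/2* k 3≤k) ℚ[w,r].* ι (nestedTraceSum k M)
        ℚ[w,r].≈ scalar (1/2* k 3≤k) ℚ[w,r].* ι (traceSum k M))
  ×
  (∀ (black : Strand) (k : ℕ) (3≤k : 3 ≤ k) (L : Link) → NonSplit L → Alternating L →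
    ∀ {D : Diagram} (d : D IsReducedAlternatingDiagramOf L) →
      let A-B = adjacencyMatrix (G*B black d)
          A-W = adjacencyMatrix (G*W black d) in
      (∀ CWR → IsCWR black k L CWR →
         CWR ≈² (cycleSum (G*B black d) k , cycleSum (G*W black d) k))
    × ι (cycleSum (G*B black d) k) ℚ[w,r].≈ scalar (1/2* k 3≤k) ℚ[w,r].* ι (traceSum k A-B)
    × ι (cycleSum (G*W black d) k) ℚ[w,r].≈ scalar (1/2* k 3≤k) ℚ[w,r].* ι (traceSum k A-W))
theorem5p4 =
  (λ n G k 3≤k → cycleSum≈nestedTraceSum G k 3≤k , scaled-nestedTraceSum≈traceSum G k 3≤k) ,
  (λ black k 3≤k L _ _ d →
    -- `isCWR` compares the value with the pair from every reduced alternating diagram. At `d` that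
    -- pair is, by definition, formed of the cycle sums of `G*B` and `G*W`.
    (λ CWR isCWR → let (eqB , eqW) = isCWR d in ℤ[w,r].sym eqB , ℤ[w,r].sym eqW) ,
    cycleSum≈traceSum (G*B black d) k 3≤k ,
    cycleSum≈traceSum (G*W black d) k 3≤k)
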